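{- Let $T$ be a tree shape on $n$ nodes with a root $u_0$ such that every root-to-leaf path of $T$ contains $O(k)$ turning points. Then, in the connectivity graph model, $T$ can be grown from a single node (placed at $u_0$) in $O(k\log n)$ time steps; specifically, the process "BFS on line segments" does so: in phases $i=1,2,\dots$, for every line segment $s_i$ of $T$ at segment distance $i$ from $u_0$, with endpoints $u_{i-1}$ (closer to $u_0$) and $u_i$, it grows $s_i$ together with $u_i$ starting from $u_{i-1}$ by fast line growth, all these segments in parallel.
   Context: Shapes. Grid points are integer pairs $(x,y)$; two grid points are adjacent if they are at orthogonal (Manhattan) distance $1$. A shape $S=(V,E)$ is a finite connected graph whose nodes occupy distinct grid points and whose edges join only pairs of nodes occupying adjacent points; shapes are considered up to translation, and $n=|V|$. Growth operations. One node, the anchor $u_0$, is stationary; other nodes move relative to it, and a tree is rooted at $u_0$. A growth operation on a node $u$ toward an adjacent grid point $p$ either (i) if $u$ has no edge to $p$, creates a new node $u'$ at $p$ with edge $uu'$; or (ii) if $p$ is occupied by a node $v$ with $uv\in E$, creates a new node $u'$ at $p$, replaces edge $uv$ by edges $uu',u'v$, and translates by one unit, along the axis of $uv$, the part of the tree hanging from whichever of $u,v$ is farther from $u_0$, away from the other endpoint. In one time step a set of operations is applied concurrently, each node receiving at most one operation and all operations having the same cardinal direction; the displacement of each node is the sum of the unit vectors contributed by the operations on its path to $u_0$. The set is collision-free if no two nodes collide during these motions or end at the same point. Growth processes (connectivity graph model). A growth process from an initial shape $S_0$ performs time steps $t=1,2,\dots$, each applying a collision-free set of growth operations to the current shape;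 no edges are deleted and no edges are created other than by the operations. It grows $S$ from $S_0$ in $t_f$ time steps if the shape obtained after step $t_f$ is $S$. Turning points. A node $u$ of a path is a turning point of the path if it is an endpoint or its two path-neighbors $v_1,v_2$ satisfy $v_1u\perp uv_2$. A root-to-leaf path of $T$ is thus an alternating sequence $(u_0,s_1,u_1,\dots,s_j,u_j)$ of turning points and maximal straight line segments; the segment distance of $s_i$ (and of $u_i$) from $u_0$ is $i$. Fast line growth grows a straight segment of length $m$ from a single node in $O(\log m)$ time steps by repeatedly having every node of the segment generate a new node along the segment direction. -}

module Defs where

open import Data.Bool using (if_then_else_)
open import Data.Empty using (⊥)
open import Data.Integer as ℤ using (ℤ; +_; 0ℤ; 1ℤ; -1ℤ)
open import Data.List using (List; []; _∷_; _++_; length)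
open import Data.List.Membership.Propositional using (_∈_; _∉_)
open import Data.List.Relation.Unary.All as All using ()
open import Data.List.Relation.Unary.AllPairs as AllPairs using ()
open import Data.List.Relation.Unary.Any using (here)
open import Data.List.Relation.Unary.Unique.Propositional using (Unique)
open import Data.Nat as ℕ using (ℕ; zero; suc; pred; _≤_)
open import Data.Product using (_×_; _,_; ∃-syntax)
open import Data.Product.Properties using (≡-dec)
open import Data.Sum using (_⊎_)
open import Function.Bundles using (_⇔_)
open import Level using (0ℓ)
open import Relation.Binary.Construct.Closure.ReflexiveTransitive using (Star; ε)
open import Relation.Binary.Construct.Closure.Symmetric using (SymClosure)
open import Relation.Binary.Core using (Rel)
import Relation.Binary.Definitions as Bin
open import Relation.Binary.PropositionalEquality using (_≡_; _≢_; refl)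
open import Relation.Nullary using (¬_; Dec; no; does)
open import Relation.Nullary.Decidable using (_×-dec_; _⊎-dec_)
import Relation.Unary as Un

Point : Set
Point = ℤ × ℤ

origin : Point
origin = 0ℤ , 0ℤ

_≟_ : Bin.DecidableEquality Point
_≟_ = ≡-dec ℤ._≟_ ℤ._≟_

infixl 6 _⊕_ _⊖_
infixl 7 _•_

_⊕_ _⊖_ : Point → Point → Point
(x , y) ⊕ (x′ , y′) = x ℤ.+ x′ , y ℤ.+ y′
(x , y) ⊖ (x′ , y′) = x ℤ.- x′ , y ℤ.- y′

_•_ : ℕ → Point → Point
m • (x , y) = + m ℤ.* x , + m ℤ.* y

dot : Point → Point → ℤ
dot (x , y) (x′ , y′) = x ℤ.* x′ ℤ.+ y ℤ.* y′

manhattan : Point → Point → ℕ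
manhattan (x , y) (x′ , y′) = ℤ.∣ x ℤ.- x′ ∣ ℕ.+ ℤ.∣ y ℤ.- y′ ∣

data Dir : Set where
  north east south west : Dir

vec : Dir → Point
vec north = 0ℤ  , 1ℤ
vec east  = 1ℤ  , 0ℤ
vec south = 0ℤ  , -1ℤ
vec west  = -1ℤ , 0ℤ

-- Since nodes occupy distinct points, a node is identified with the
-- point it currently occupies.
record Shape : Set₁ where
  infix 4 _~_
  field
    nodes      : List Point
    distinct   : Unique nodes
    _~_        : Rel Point 0ℓ
    _~?_       : Bin.Decidable _~_
    ~-sym      : ∀ {p q} → p ~ q → q ~ p
    ~-node     : ∀ {p q} → p ~ q → p ∈ nodes
    ~-adjacent : ∀ {p q} → p ~ q → manhattan p q ≡ 1
    connected  : ∀ {p q} → p ∈ nodes → q ∈ nodes → Star _~_ p q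

  size : ℕ
  size = length nodes

open Shape using (nodes; size)

infix 4 _≋_

-- Equality of placed shapes.  No translation is quotiented out: a growth
-- process has a stationary anchor, which fixes the placement.
_≋_ : Shape → Shape → Set
S ≋ S′ = (∀ p → p ∈ nodes S ⇔ p ∈ nodes S′)
       × (∀ p q → Shape._~_ S p q ⇔ Shape._~_ S′ p q)

singleton : Point → Shape
singleton p = record
  { nodes      = p ∷ []
  ; distinct   = All.[] AllPairs.∷ AllPairs.[]
  ; _~_        = λ _ _ → ⊥
  ; _~?_       = λ _ _ → no (λ ())
  ; ~-sym      = λ ()
  ; ~-node     = λ ()
  ; ~-adjacent = λ ()
  ; connected  = λ { (here refl) (here refl) → ε }
  }

-- Path S a b ps: ps is a simple path from a to b.  The nodes are listed
-- backwards, so b is the head of ps and a is its last element.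
data Path (S : Shape) (a : Point) : Point → List Point → Set where
  start  : Path S a a (a ∷ [])
  extend : ∀ {b c ps} → Path S a b ps → Shape._~_ S b c → c ∉ ps →
           Path S a c (c ∷ ps)

-- Shapes are connected, so a tree shape is an acyclic one.
IsTree : Shape → Set
IsTree S = ∀ {a b ps} → Path S a b ps → 3 ≤ length ps → ¬ Shape._~_ S b a

Perpendicular : Point → Point → Point → Set
Perpendicular v₁ u v₂ = dot (u ⊖ v₁) (v₂ ⊖ u) ≡ 0ℤ

perpendicular? : ∀ v₁ u v₂ → Dec (Perpendicular v₁ u v₂)
perpendicular? v₁ u v₂ = dot (u ⊖ v₁) (v₂ ⊖ u) ℤ.≟ 0ℤ

innerTurns : List Point → ℕ
innerTurns (v₁ ∷ u ∷ v₂ ∷ ps) =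
  (if does (perpendicular? v₁ u v₂) then 1 else 0) ℕ.+ innerTurns (u ∷ v₂ ∷ ps)
innerTurns _ = 0

turningPoints : List Point → ℕ
turningPoints []           = 0
turningPoints (_ ∷ [])     = 1
turningPoints (p ∷ q ∷ ps) = 2 ℕ.+ innerTurns (p ∷ q ∷ ps)

-- A path (u₀, s₁, u₁, …, sⱼ, uⱼ) has j + 1 turning points and j segments.
segments : List Point → ℕ
segments ps = pred (turningPoints ps)

-- A leaf is a node without children; in particular the root of a
-- one-node tree is a leaf, and a root of degree one is not.
RootToLeaf : Shape → Point → Point → List Point → Set
RootToLeaf T u₀ v ps = Path T u₀ v ps × (∀ w → Shape._~_ T v w → w ∈ ps)

-- The points b + m d, …, b + 2 d, b + d.
line : Point → Dir → ℕ → List Point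
line b d zero    = []
line b d (suc m) = (b ⊕ suc m • vec d) ∷ line b d m

-- A maximal straight segment sᵢ of T with uᵢ₋₁ = b and uᵢ = b + m d.
-- When the paths to different leaves leave a straight line at different
-- nodes, their segments are initial parts of the one considered here.
record Segment (T : Shape) (u₀ : Point) (i : ℕ) (b : Point) (d : Dir) (m : ℕ) : Set where
  field
    nonempty     : 1 ≤ m
    before       : List Point
    path-to-base : Path T u₀ b before
    path-to-end  : Path T u₀ (b ⊕ m • vec d) (line b d m ++ before)
    base-dist    : suc (segments before) ≡ i
    end-dist     : segments (line b d m ++ before) ≡ i
    maximal      : ¬ Shape._~_ T (b ⊕ m • vec d) (b ⊕ suc m • vec d)

-- Nodes present after a step: old v is a previous node v, new u is the
-- node generated by u.
data Body : Set where
  old new : Point → Body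

-- The operations of one time step: every node u with Op u grows toward
-- u ⊕ vec dir.
record Operations (S : Shape) : Set₁ where
  field
    dir : Dir
    Op  : Un.Pred Point 0ℓ
    op? : Un.Decidable Op
    op∈ : ∀ {u} → Op u → u ∈ nodes S

  Toward : Rel Point 0ℓ
  Toward u v = Op u × v ≡ u ⊕ vec dir

  -- For an edge uv: it is replaced by two edges.
  Splits : Rel Point 0ℓ
  Splits u v = Toward u v ⊎ Toward v u

  splits? : Bin.Decidable Splits
  splits? u v = (op? u ×-dec (v ≟ (u ⊕ vec dir))) ⊎-dec (op? v ×-dec (u ≟ (v ⊕ vec dir)))

  -- The argument is a path from the anchor, so in c ∷ p ∷ ps the node p
  -- is the parent of c; splitting pc pushes c away from p, whichever of
  -- the two received the operation.
  displacement : List Point → Point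
  displacement (c ∷ p ∷ ps) =
    (if does (splits? p c) then c ⊖ p else origin) ⊕ displacement (p ∷ ps)
  displacement _ = origin

  Present : Un.Pred Body 0ℓ
  Present (old v) = v ∈ nodes S
  Present (new u) = Op u

  data Edge : Rel Body 0ℓ where
    kept    : ∀ {u v} → Shape._~_ S u v → ¬ Splits u v → Edge (old u) (old v)
    grown   : ∀ {u} → Op u → Edge (old u) (new u)
    spliced : ∀ {u v} → Shape._~_ S u v → Toward u v → Edge (new u) (old v)

  -- A generated node emerges from its generator during the step and ends
  -- next to it.
  initial : Body → Point
  initial (old v) = v
  initial (new u) = u

  -- move v is the point to which a previous node v is translated.
  final : (move : Point → Point) → Body → Point
  final move (old v) = move v
  final move (new u) = move u ⊕ vec dir

record Step (u₀ : Point) (S S′ : Shape) : Set₁ where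
  field
    tree   : IsTree S
    anchor : u₀ ∈ nodes S
    ops    : Operations S

  open Operations ops public

  field
    move     : Point → Point
    move-def : ∀ {v ps} → Path S u₀ v ps → move v ≡ v ⊕ displacement ps

    -- All motions are uniform.  At time a / (a + r) of the step a body x is
    -- at the point (r • initial x ⊕ a • final move x) / (a + r).  With a ≥ 1
    -- these are the rational times in (0,1]; trajectories with integral
    -- endpoints that meet at some real time also meet at a rational one.
    collision-free : ∀ {x y} → Present x → Present y → x ≢ y → ∀ a r → 1 ≤ a →
                     r • initial x ⊕ a • final move x ≢ r • initial y ⊕ a • final move y
    nodes′ : ∀ p → p ∈ nodes S′ ⇔ (∃[ x ] Present x × final move x ≡ p)
    edges′ : ∀ p q → Shape._~_ S′ p q ⇔
             (∃[ x ] ∃[ y ] SymClosure Edge x y × final move x ≡ p × final move y ≡ q)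

infixr 5 _∷_

data Growth (u₀ : Point) : Shape → Shape → ℕ → Set₁ where
  done : ∀ {S S′} → S ≋ S′ → Growth u₀ S S′ 0
  _∷_  : ∀ {S S′ S″ t} → Step u₀ S S′ → Growth u₀ S′ S″ t → Growth u₀ S S″ (suc t)

module _ (T : Shape) (u₀ : Point) where

  -- The points of T at segment distance at most i from u₀; a point inside
  -- a segment has the segment distance of that segment.
  Within : ℕ → Point → Set
  Within i p = ∃[ ps ] Path T u₀ p ps × segments ps ≤ i

  -- S is the part of T consisting of the segments at distance at most i.
  GrownUpTo : ℕ → Shape → Set
  GrownUpTo i S =
    (∀ p → p ∈ nodes S ⇔ Within i p) ×
    (∀ p q → Shape._~_ S p q ⇔ (Shape._~_ T p q × Within i p × Within i q))

  -- A step of phase i.  Only operations of a single direction are allowed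
  -- in a step, so it advances in parallel all segments at distance i having
  -- that direction.  Each node of such a segment grown so far, including
  -- the base, generates a node along the segment, unless fewer operations
  -- suffice to complete the segment.
  record FastLineStep (i : ℕ) {S S′ : Shape} (st : Step u₀ S S′) : Set where
    open Step st using (Op; dir)
    field
      only-segments : ∀ {u} → Op u →
        ∃[ b ] ∃[ m ] Segment T u₀ i b dir m × u ∈ (b ∷ line b dir m)
      all-segments : ∀ {b m} → Segment T u₀ i b dir m →
        (∀ {u} → u ∈ nodes S → u ∈ (b ∷ line b dir m) → Op u) ⊎
        (∀ {u} → u ∈ line b dir m → u ∈ nodes S′)

  -- Phase i g: g is the remainder, from some moment of phase i on, of a run
  -- of BFS on line segments.
  data Phase : ℕ → ∀ {S t} → Growth u₀ S T t → Set₁ where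
    finish : ∀ {i S} {e : S ≋ T} → Phase i (done {S = S} {S′ = T} e)
    grow   : ∀ {i S S′ t} {st : Step u₀ S S′} {g : Growth u₀ S′ T t} →
             FastLineStep i st → Phase i g → Phase i (st ∷ g)
    next   : ∀ {i S t} {g : Growth u₀ S T t} →
             GrownUpTo i S → Phase (suc i) g → Phase i g

  BFSOnLineSegments : ∀ {t} → Growth u₀ (singleton u₀) T t → Set₁
  BFSOnLineSegments g = Phase 1 g

{-# OPTIONS --safe #-}
module Submission where

-- Each intermediate shape is the subtree of T formed by all segments at
-- distance less than i from u₀ and an initial part of those at distance i,
-- of length at most cap d for those of direction d.  A step turns cap d = w
-- into 2 w + 1: on a segment of length len the node at offset y receives an
-- operation iff y < μ := min (len − w) (w + 1), so the old node at offset x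
-- moves to x + min x μ and the node generated at y ends at 2 y + 1.  No two
-- nodes collide, since a node that would be caught up by another one lies
-- ahead of it on the same segment and is displaced at least as far.  After
-- 1 + ⌊log₂ n⌋ steps cap d is at least n, so a phase takes 4 (1 + ⌊log₂ n⌋) steps.

open import Defs
open import Data.Bool using (true; false; if_then_else_)
open import Data.Empty using (⊥; ⊥-elim)
open import Data.Integer as ℤ using (ℤ; +_; -[1+_]; 0ℤ; 1ℤ; -1ℤ)
import Data.Integer.Properties as ℤₚ
open import Data.Integer.Tactic.RingSolver using (solve-∀)
open import Data.List using (List; []; _∷_; _++_; length; filter)
open import Data.List.Membership.DecPropositional _≟_ using (_∈?_)
open import Data.List.Membership.Propositional using (_∈_; _∉_; find; lose)
open import Data.List.Membership.Propositional.Properties using (∈-∃++; ∈-++⁻; ∈-++⁺ˡ; ∈-++⁺ʳ; ∈-filter⁺; ∈-filter⁻)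
open import Data.List.Properties using (length-++; ∷-injectiveˡ; ∷-injectiveʳ)
open import Data.List.Relation.Binary.Subset.Propositional using (_⊆_)
open import Data.List.Relation.Unary.All as All using (All; []; _∷_)
open import Data.List.Relation.Unary.All.Properties using (¬Any⇒All¬; All¬⇒¬Any)
open import Data.List.Relation.Unary.AllPairs using ([]; _∷_)
open import Data.List.Relation.Unary.Any using (here; there; any?)
open import Data.List.Relation.Unary.Unique.Propositional using (Unique)
import Data.List.Relation.Unary.Unique.Propositional.Properties as Unique
open import Data.Nat as ℕ using (ℕ; zero; suc; _+_; _*_; _^_; _∸_; _⊓_; _≤_; _<_; z≤n; s≤s; NonZero; >-nonZero)
open import Data.Nat.Logarithm using (⌊log₂_⌋; ⌊log₂⌋-mono-≤; ⌊log₂[2^n]⌋≡n)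
open import Data.Nat.Properties hiding (_≟_)
import Data.Nat.Tactic.RingSolver as ℕ-Solver
open import Data.Product as Product using (Σ-syntax; ∃-syntax; _×_; _,_; proj₁; proj₂)
open import Data.Sum as Sum using (_⊎_; inj₁; inj₂)
open import Data.Unit using (tt)
open import Function using (_∘_)
open import Function.Bundles using (_⇔_; mk⇔; Equivalence)
open import Level using (0ℓ)
open import Relation.Binary.Construct.Closure.ReflexiveTransitive as Star using (Star; ε; _◅_; _◅◅_)
open import Relation.Binary.Construct.Closure.Symmetric using (SymClosure; fwd; bwd; symmetric)
open import Relation.Binary.Core using (Rel)
open import Relation.Binary.Definitions using (DecidableEquality)
open import Relation.Binary.PropositionalEquality
open import Relation.Nullary using (¬_; Dec; yes; no; does; contradiction)
open import Relation.Nullary.Decidable using (dec-true; dec-false; _×-dec_; _⊎-dec_; ¬?; map′)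
open import Relation.Unary using (Pred; Decidable)
open Equivalence using (to; from)

-- Segment distance, direction of the last segment and offset on it are all read off a node's unique
-- root path in `T`. Every intermediate shape is therefore described in the coordinates of `T`, and
-- a step changes a single number, `cap d`. This works because in phase i nothing hangs off a
-- segment at distance i: its sideways branches have distance i + 1 and are not yet present, so
-- displacing its nodes drags nothing else along. The remaining danger is that a moving node hits a
-- node of another segment ahead of it on the same grid line. It cannot: the stretch it passes over
-- stays within the final length of its segment, so the points there belong to that segment in `T`,
-- whether occupied yet or not. In the minimum defining μ, w + 1 counts the nodes available for
-- operations, base included, and len - w the nodes still missing. The factor 4 appears because a
-- step admits only one direction, so the four directions are served one after another.

-- Points, directions and right angles on the grid.

at : Point → Dir → ℕ → Point
at b d x = b ⊕ x • vec d

⊕-identityʳ : ∀ p → p ⊕ origin ≡ p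
⊕-identityʳ (x , y) = cong₂ _,_ (ℤₚ.+-identityʳ x) (ℤₚ.+-identityʳ y)

•-suc : ∀ n v → v ⊕ n • v ≡ suc n • v
•-suc n (x , y) = cong₂ _,_ (sym (ℤₚ.suc-* (+ n) x)) (sym (ℤₚ.suc-* (+ n) y))

⊕-identityˡ : ∀ p → origin ⊕ p ≡ p
⊕-identityˡ (x , y) = cong₂ _,_ (ℤₚ.+-identityˡ x) (ℤₚ.+-identityˡ y)

at-zero : ∀ b d → at b d 0 ≡ b
at-zero b _ = ⊕-identityʳ b

at-+ : ∀ b d x y → at (at b d x) d y ≡ at b d (x + y)
at-+ (b₁ , b₂) d x y = cong₂ _,_ (distrib b₁ _) (distrib b₂ _)
  where
  ring : ∀ b v m n → b ℤ.+ m ℤ.* v ℤ.+ n ℤ.* v ≡ b ℤ.+ (m ℤ.+ n) ℤ.* v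
  ring = solve-∀
  distrib : ∀ b v → b ℤ.+ + x ℤ.* v ℤ.+ + y ℤ.* v ≡ b ℤ.+ + (x + y) ℤ.* v
  distrib b v = ring b v (+ x) (+ y)

at-one : ∀ b d → at b d 1 ≡ b ⊕ vec d
at-one (b₁ , b₂) d = cong₂ _,_ (cong (ℤ._+_ b₁) (ℤₚ.*-identityˡ _)) (cong (ℤ._+_ b₂) (ℤₚ.*-identityˡ _))

at-suc : ∀ b d x → at b d (suc x) ≡ at b d x ⊕ vec d
at-suc b d x = begin
  at b d (suc x)       ≡⟨ cong (at b d) (+-comm 1 x) ⟩
  at b d (x + 1)       ≡⟨ at-+ b d x 1 ⟨
  at (at b d x) d 1    ≡⟨ at-one (at b d x) d ⟩
  at b d x ⊕ vec d     ∎
  where open ≡-Reasoning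

⊕-⊖-cancel : ∀ p v → (p ⊕ v) ⊖ p ≡ v
⊕-⊖-cancel (x , y) (v , w) = cong₂ _,_ (ring x v) (ring y w)
  where
  ring : ∀ x v → x ℤ.+ v ℤ.- x ≡ v
  ring = solve-∀

-- Only the values on unit vectors matter. As a left inverse of `vec` it yields decidable equality
-- of directions and lets `dirOf` read a direction off two points.
toDir : Point → Dir
toDir (+ suc _  , _)        = east
toDir (-[1+ _ ] , _)        = west
toDir (+ 0      , -[1+ _ ]) = south
toDir (+ 0      , + _)      = north

toDir-vec : ∀ d → toDir (vec d) ≡ d
toDir-vec north = refl
toDir-vec east  = refl
toDir-vec south = refl
toDir-vec west  = refl

vec-injective : ∀ {d e} → vec d ≡ vec e → d ≡ e
vec-injective {d} {e} eq = trans (sym (toDir-vec d)) (trans (cong toDir eq) (toDir-vec e))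

_≟ᵈ_ : DecidableEquality Dir
d ≟ᵈ e = map′ vec-injective (cong vec) (vec d ≟ vec e)

adjacent-dir : ∀ p q → manhattan p q ≡ 1 → ∃[ d ] q ≡ p ⊕ vec d
adjacent-dir (x , y) (x′ , y′) eq = go (x ℤ.- x′) (y ℤ.- y′) refl refl eq
  where
  ring : ∀ x x′ → x′ ≡ x ℤ.+ ℤ.- (x ℤ.- x′)
  ring = solve-∀
  shift : ∀ x x′ {a} → x ℤ.- x′ ≡ a → x′ ≡ x ℤ.+ ℤ.- a
  shift x x′ refl = ring x x′
  go : ∀ a b → x ℤ.- x′ ≡ a → y ℤ.- y′ ≡ b → ℤ.∣ a ∣ + ℤ.∣ b ∣ ≡ 1 →
       ∃[ d ] (x′ , y′) ≡ (x , y) ⊕ vec d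
  go (+ 0)     (+ 1)      p q refl = south , cong₂ _,_ (shift x x′ p) (shift y y′ q)
  go (+ 0)     (-[1+ 0 ]) p q refl = north , cong₂ _,_ (shift x x′ p) (shift y y′ q)
  go (+ 1)     (+ 0)      p q refl = west  , cong₂ _,_ (shift x x′ p) (shift y y′ q)
  go (-[1+ 0 ]) (+ 0)     p q refl = east  , cong₂ _,_ (shift x x′ p) (shift y y′ q)

manhattan-refl : ∀ p → manhattan p p ≡ 0
manhattan-refl (x , y) = cong₂ (λ a b → ℤ.∣ a ∣ + ℤ.∣ b ∣) (ℤₚ.+-inverseʳ x) (ℤₚ.+-inverseʳ y)

-- Paths list the newest node first, so both differences compared by `Perpendicular` are negated
-- step vectors; the two signs cancel.
dot-steps : ∀ q d e →
            dot ((q ⊕ vec e) ⊖ (q ⊕ vec e ⊕ vec d)) (q ⊖ (q ⊕ vec e)) ≡ dot (vec d) (vec e)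
dot-steps (x , y) d e = ring x y _ _ _ _
  where
  ring : ∀ x y d₁ d₂ e₁ e₂ →
         (x ℤ.+ e₁ ℤ.- (x ℤ.+ e₁ ℤ.+ d₁)) ℤ.* (x ℤ.- (x ℤ.+ e₁)) ℤ.+
         (y ℤ.+ e₂ ℤ.- (y ℤ.+ e₂ ℤ.+ d₂)) ℤ.* (y ℤ.- (y ℤ.+ e₂)) ≡ d₁ ℤ.* e₁ ℤ.+ d₂ ℤ.* e₂
  ring = solve-∀

-- The three ways to continue by d a path whose last step was e: stay on the segment, fall back onto
-- the previous node, which a simple path forbids, or open a new segment.
data Directions (d e : Dir) : Set where
  same          : d ≡ e → Directions d e
  opposite      : vec e ⊕ vec d ≡ origin → Directions d e
  perpendicular : dot (vec d) (vec e) ≡ 0ℤ → Directions d e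

compareDir : ∀ d e → Directions d e
compareDir north north = same refl
compareDir north east  = perpendicular refl
compareDir north south = opposite refl
compareDir north west  = perpendicular refl
compareDir east  north = perpendicular refl
compareDir east  east  = same refl
compareDir east  south = perpendicular refl
compareDir east  west  = opposite refl
compareDir south north = opposite refl
compareDir south east  = perpendicular refl
compareDir south south = same refl
compareDir south west  = perpendicular refl
compareDir west  north = perpendicular refl
compareDir west  east  = opposite refl
compareDir west  south = perpendicular refl
compareDir west  west  = same refl

⊕-opposite : ∀ d e → vec e ⊕ vec d ≡ origin → ∀ p → p ⊕ vec e ⊕ vec d ≡ p
⊕-opposite d e eq p@(x , y) =
  trans (cong₂ _,_ (ℤₚ.+-assoc x _ _) (ℤₚ.+-assoc y _ _))
    (trans (cong (p ⊕_) eq) (⊕-identityʳ p))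

dot-self : ∀ d → dot (vec d) (vec d) ≢ 0ℤ
dot-self north ()
dot-self east ()
dot-self south ()
dot-self west ()

¬perpendicular-line : ∀ q d → ¬ Perpendicular (q ⊕ vec d ⊕ vec d) (q ⊕ vec d) q
¬perpendicular-line q d eq = dot-self d (trans (sym (dot-steps q d d)) eq)

¬perpendicular-back : ∀ b d → ¬ Perpendicular (b ⊕ vec d) b (b ⊕ vec d)
¬perpendicular-back (x , y) d eq =
  dot-self d (trans (ring x y _ _) (cong ℤ.-_ eq))
  where
  ring : ∀ x y d₁ d₂ → d₁ ℤ.* d₁ ℤ.+ d₂ ℤ.* d₂ ≡
         ℤ.- ((x ℤ.- (x ℤ.+ d₁)) ℤ.* (x ℤ.+ d₁ ℤ.- x) ℤ.+ (y ℤ.- (y ℤ.+ d₂)) ℤ.* (y ℤ.+ d₂ ℤ.- y))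
  ring = solve-∀

at-two-≢ : ∀ b d x → at b d x ≢ at b d (2 + x)
at-two-≢ b d x eq = go d (trans eq (trans (at-suc b d (suc x)) (cong (_⊕ vec d) (at-suc b d x))))
  where
  ring : ∀ x s → x ℤ.+ s ℤ.+ s ℤ.- x ≡ s ℤ.+ s
  ring = solve-∀
  step : ∀ {x} s → x ≡ x ℤ.+ s ℤ.+ s → 0ℤ ≡ s ℤ.+ s
  step {x} s eq = trans (sym (ℤₚ.+-inverseʳ x)) (trans (cong (ℤ._- x) eq) (ring x s))
  go : ∀ {p} d → p ≢ p ⊕ vec d ⊕ vec d
  go north eq with () ← step 1ℤ (cong proj₂ eq)
  go east  eq with () ← step 1ℤ (cong proj₁ eq)
  go south eq with () ← step -1ℤ (cong proj₂ eq)
  go west  eq with () ← step -1ℤ (cong proj₁ eq)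

-- Meetings of two uniform motions along a common axis.

module _ (a r : ℕ) (1≤a : 1 ≤ a) where

  private
    instance
      _ : NonZero a
      _ = >-nonZero 1≤a
      a+r≢0 : NonZero (r + a)
      a+r≢0 = >-nonZero (≤-trans 1≤a (m≤n+m a r))

  -- Nothing moves across the axis, so both sides are r + a times a fixed coordinate. The multiple
  -- of 0 in the conclusion gives it the shape of a coordinate of `at`.
  meet-across : ∀ {y z k l} →
    + r ℤ.* y ℤ.+ + a ℤ.* (y ℤ.+ + k ℤ.* 0ℤ) ≡ + r ℤ.* z ℤ.+ + a ℤ.* (z ℤ.+ + l ℤ.* 0ℤ) →
    ∀ t → z ≡ y ℤ.+ + t ℤ.* 0ℤ
  meet-across {y} {z} {k} {l} eq t = trans (sym y≡z) (sym (trans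
    (cong (λ u → y ℤ.+ u) (ℤₚ.*-zeroʳ (+ t))) (ℤₚ.+-identityʳ y)))
    where
    ring : ∀ r a y k → r ℤ.* y ℤ.+ a ℤ.* (y ℤ.+ k ℤ.* 0ℤ) ≡ (r ℤ.+ a) ℤ.* y
    ring = solve-∀
    y≡z : y ≡ z
    y≡z = ℤₚ.*-cancelˡ-≡ (+ (r + a)) y z
      (trans (sym (ring (+ r) (+ a) y (+ k))) (trans eq (ring (+ r) (+ a) z (+ l))))

  -- A body displaced by k meets, at time a / (a + r), one that starts t units
  -- ahead of it and is displaced by l.
  Catch : ℕ → ℕ → ℕ → Set
  Catch t k l = r * t + a * (t + l) ≡ a * k

  -- As s is a sign, (z - y) s is the lead of the second body in the direction of motion. Its sign
  -- decides which body is behind, and the meeting equation multiplied by s becomes `Catch`.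
  meet-along : ∀ {y z} k l s → s ℤ.* s ≡ 1ℤ →
    + r ℤ.* y ℤ.+ + a ℤ.* (y ℤ.+ + k ℤ.* s) ≡ + r ℤ.* z ℤ.+ + a ℤ.* (z ℤ.+ + l ℤ.* s) →
    (∃[ t ] z ≡ y ℤ.+ + t ℤ.* s × Catch t k l) ⊎ (∃[ t ] y ≡ z ℤ.+ + t ℤ.* s × Catch t l k)
  meet-along {y} {z} k l s ss eq = go ((z ℤ.- y) ℤ.* s) refl
    where
    open ≡-Reasoning
    shift : ∀ y z → z ≡ y ℤ.+ (z ℤ.- y) ℤ.* s ℤ.* s
    shift y z = begin
      z                               ≡⟨ ring y z ⟩
      y ℤ.+ (z ℤ.- y) ℤ.* 1ℤ          ≡⟨ cong (λ u → y ℤ.+ (z ℤ.- y) ℤ.* u) ss ⟨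
      y ℤ.+ (z ℤ.- y) ℤ.* (s ℤ.* s)   ≡⟨ cong (ℤ._+_ y) (ℤₚ.*-assoc (z ℤ.- y) s s) ⟨
      y ℤ.+ (z ℤ.- y) ℤ.* s ℤ.* s     ∎
      where
      ring : ∀ y z → z ≡ y ℤ.+ (z ℤ.- y) ℤ.* 1ℤ
      ring = solve-∀
    catch : ∀ {y z} k l t → (z ℤ.- y) ℤ.* s ≡ + t →
      + r ℤ.* y ℤ.+ + a ℤ.* (y ℤ.+ + k ℤ.* s) ≡ + r ℤ.* z ℤ.+ + a ℤ.* (z ℤ.+ + l ℤ.* s) →
      z ≡ y ℤ.+ + t ℤ.* s × Catch t k l
    catch {y} {z} k l t t≡ eq = trans (shift y z) (cong (λ u → y ℤ.+ u ℤ.* s) t≡) , ℤₚ.+-injective (begin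
      + (r * t + a * (t + l))
        ≡⟨ cong₂ ℤ._+_ (ℤₚ.pos-* r t) (trans (ℤₚ.pos-* a (t + l)) (cong (+ a ℤ.*_) (ℤₚ.pos-+ t l))) ⟩
      + r ℤ.* + t ℤ.+ + a ℤ.* (+ t ℤ.+ + l)
        ≡⟨ cong₂ (λ u v → + r ℤ.* u ℤ.+ + a ℤ.* (u ℤ.+ v)) (sym t≡) (unit (+ l)) ⟩
      + r ℤ.* D ℤ.+ + a ℤ.* (D ℤ.+ + l ℤ.* (s ℤ.* s))
        ≡⟨ ring (+ r) (+ a) y z (+ l) s ⟩
      (+ r ℤ.* z ℤ.+ + a ℤ.* (z ℤ.+ + l ℤ.* s) ℤ.- (+ r ℤ.+ + a) ℤ.* y) ℤ.* s
        ≡⟨ cong (λ u → (u ℤ.- (+ r ℤ.+ + a) ℤ.* y) ℤ.* s) (sym eq) ⟩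
      (+ r ℤ.* y ℤ.+ + a ℤ.* (y ℤ.+ + k ℤ.* s) ℤ.- (+ r ℤ.+ + a) ℤ.* y) ℤ.* s
        ≡⟨ ring′ (+ r) (+ a) y (+ k) s ⟩
      + a ℤ.* (+ k ℤ.* (s ℤ.* s))
        ≡⟨ cong (+ a ℤ.*_) (unit (+ k)) ⟨
      + a ℤ.* + k
        ≡⟨ ℤₚ.pos-* a k ⟨
      + (a * k) ∎)
      where
      D = (z ℤ.- y) ℤ.* s
      unit : ∀ v → v ≡ v ℤ.* (s ℤ.* s)
      unit v = trans (sym (ℤₚ.*-identityʳ v)) (cong (v ℤ.*_) (sym ss))
      ring : ∀ r a y z l s → r ℤ.* ((z ℤ.- y) ℤ.* s) ℤ.+ a ℤ.* ((z ℤ.- y) ℤ.* s ℤ.+ l ℤ.* (s ℤ.* s)) ≡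
             (r ℤ.* z ℤ.+ a ℤ.* (z ℤ.+ l ℤ.* s) ℤ.- (r ℤ.+ a) ℤ.* y) ℤ.* s
      ring = solve-∀
      ring′ : ∀ r a y k s → (r ℤ.* y ℤ.+ a ℤ.* (y ℤ.+ k ℤ.* s) ℤ.- (r ℤ.+ a) ℤ.* y) ℤ.* s ≡
              a ℤ.* (k ℤ.* (s ℤ.* s))
      ring′ = solve-∀
    swap : ∀ y z s → (y ℤ.- z) ℤ.* s ≡ ℤ.- ((z ℤ.- y) ℤ.* s)
    swap = solve-∀
    go : ∀ D → (z ℤ.- y) ℤ.* s ≡ D →
      (∃[ t ] z ≡ y ℤ.+ + t ℤ.* s × Catch t k l) ⊎ (∃[ t ] y ≡ z ℤ.+ + t ℤ.* s × Catch t l k)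
    go (+ t)      D≡ = inj₁ (t , catch k l t D≡ eq)
    go (-[1+ t ]) D≡ = inj₂ (suc t , catch l k (suc t) (trans (swap y z s) (cong ℤ.-_ D≡)) (sym eq))

  meet : ∀ d {u v k l} →
    r • u ⊕ a • at u d k ≡ r • v ⊕ a • at v d l →
    (∃[ t ] v ≡ at u d t × Catch t k l) ⊎ (∃[ t ] u ≡ at v d t × Catch t l k)
  meet north {k = k} {l} eq with meet-along k l 1ℤ refl (cong proj₂ eq)
  ... | inj₁ (t , e , c) = inj₁ (t , cong₂ _,_ (meet-across {k = k} {l} (cong proj₁ eq) t) e , c)
  ... | inj₂ (t , e , c) = inj₂ (t , cong₂ _,_ (meet-across {k = l} {k} (sym (cong proj₁ eq)) t) e , c)
  meet east {k = k} {l} eq with meet-along k l 1ℤ refl (cong proj₁ eq)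
  ... | inj₁ (t , e , c) = inj₁ (t , cong₂ _,_ e (meet-across {k = k} {l} (cong proj₂ eq) t) , c)
  ... | inj₂ (t , e , c) = inj₂ (t , cong₂ _,_ e (meet-across {k = l} {k} (sym (cong proj₂ eq)) t) , c)
  meet south {k = k} {l} eq with meet-along k l -1ℤ refl (cong proj₂ eq)
  ... | inj₁ (t , e , c) = inj₁ (t , cong₂ _,_ (meet-across {k = k} {l} (cong proj₁ eq) t) e , c)
  ... | inj₂ (t , e , c) = inj₂ (t , cong₂ _,_ (meet-across {k = l} {k} (sym (cong proj₁ eq)) t) e , c)
  meet west {k = k} {l} eq with meet-along k l -1ℤ refl (cong proj₁ eq)
  ... | inj₁ (t , e , c) = inj₁ (t , cong₂ _,_ e (meet-across {k = k} {l} (cong proj₂ eq) t) , c)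
  ... | inj₂ (t , e , c) = inj₂ (t , cong₂ _,_ e (meet-across {k = l} {k} (sym (cong proj₂ eq)) t) , c)

  -- Without the term in r, `Catch` compares positions at the end of the step, when the body behind
  -- has at least drawn level.
  catch-≤ : ∀ t {k l} → Catch t k l → t + l ≤ k
  catch-≤ t {k} {l} eq = *-cancelˡ-≤ a (≤-trans (m≤n+m _ (r * t)) (≤-reflexive eq))

  catch-zero : ∀ {k l} → Catch 0 k l → l ≡ k
  catch-zero {k} {l} eq = *-cancelˡ-≡ l k a (subst (λ n → n + a * l ≡ a * k) (*-zeroʳ r) eq)

-- Arithmetic of a single segment during a step.

-- One segment of length len, of which the first w nodes beyond the base are
-- present: the nodes at offset y < quota w len receive an operation.
quota : ℕ → ℕ → ℕ
quota w len = (len ∸ w) ⊓ suc w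

module _ (w len : ℕ) where

  private
    μ = quota w len

  <quota⇒≤w : ∀ {y} → y < μ → y ≤ w
  <quota⇒≤w y<μ = m<1+n⇒m≤n (<-≤-trans y<μ (m⊓n≤n (len ∸ w) (suc w)))

  <quota⇒+w<len : ∀ {y} → y < μ → y + w < len
  <quota⇒+w<len {y} y<μ = m<n∸o⇒m+o<n (<-≤-trans y<μ (m⊓n≤m (len ∸ w) (suc w)))
    where
    m<n∸o⇒m+o<n : y < len ∸ w → y + w < len
    m<n∸o⇒m+o<n lt = m≤n∸o⇒m+o≤n (suc y) (<⇒≤ (m<n∸o⇒o<n lt)) lt
      where
      m<n∸o⇒o<n : y < len ∸ w → w < len
      m<n∸o⇒o<n lt = ≰⇒> (λ len≤w → n≮0 (subst (y <_) (m≤n⇒m∸n≡0 len≤w) lt))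
      m≤n∸o⇒m+o≤n : ∀ m → w ≤ len → m ≤ len ∸ w → m + w ≤ len
      m≤n∸o⇒m+o≤n m w≤len le = ≤-trans (+-monoˡ-≤ w le) (≤-reflexive (m∸n+n≡m w≤len))

  <quota⇒<len : ∀ {y} → y < μ → suc y ≤ len
  <quota⇒<len {y} y<μ = ≤-trans (s≤s (m≤m+n y w)) (<quota⇒+w<len y<μ)

  <quota⇒≤len : ∀ {y} → y < μ → y ≤ len
  <quota⇒≤len y<μ = <⇒≤ (<quota⇒<len y<μ)

  <quota⇒new≤len : ∀ {y} → y < μ → suc (y + y) ≤ len
  <quota⇒new≤len {y} y<μ = ≤-trans (s≤s (+-monoʳ-≤ y (<quota⇒≤w y<μ))) (<quota⇒+w<len y<μ)

  <quota⇒new≤cap : ∀ {y} → y < μ → suc (y + y) ≤ suc (w + w)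
  <quota⇒new≤cap y<μ = s≤s (+-mono-≤ (<quota⇒≤w y<μ) (<quota⇒≤w y<μ))

  old≤cap : ∀ {x} → x ≤ w → x + x ⊓ μ ≤ suc (w + w)
  old≤cap {x} x≤w = m≤n⇒m≤1+n (+-mono-≤ x≤w (≤-trans (m⊓n≤m x μ) x≤w))

  -- For len ≤ w the quota is 0 and nothing moves; otherwise x is at most w and the displacement at
  -- most len - w.
  old≤len : ∀ {x} → x ≤ w → x ≤ len → x + x ⊓ μ ≤ len
  old≤len {x} x≤w x≤len with ≤-total len w
  ... | inj₁ len≤w = ≤-trans (≤-reflexive (trans (cong (λ n → x + x ⊓ (n ⊓ suc w)) (m≤n⇒m∸n≡0 len≤w))
                       (trans (cong (_+_ x) (⊓-zeroʳ x)) (+-identityʳ x)))) x≤len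
  ... | inj₂ w≤len = ≤-trans (+-mono-≤ x≤w (≤-trans (m⊓n≤n x μ) (m⊓n≤m (len ∸ w) (suc w))))
                       (≤-reflexive (m+[n∸m]≡n w≤len))

  -- For w ≤ len the sum μ + w is the length grown after the step, the smaller of len and 2 w + 1.
  ≤quota+w : ∀ {z} → z ≤ len → z ≤ suc (w + w) → z ≤ μ + w
  ≤quota+w {z} z≤len z≤cap with ⊓-sel (len ∸ w) (suc w)
  ... | inj₁ eq = ≤-trans z≤len (≤-trans (m≤n+m∸n len w) (≤-reflexive (trans (+-comm w _) (cong (_+ w) (sym eq)))))
  ... | inj₂ eq = ≤-trans z≤cap (≤-reflexive (cong (_+ w) (sym eq)))

  quota-full : ∀ {x} → suc (w + w) ≤ len → x ≤ w → x < μ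
  quota-full {x} full x≤w = ⊓-glb (≤-trans (s≤s x≤w) (m+n≤o⇒m≤o∸n (suc w) full)) (s≤s x≤w)

-- The edge from offset x to x + 1 is split when x < μ, which adds one to the displacement;
-- otherwise, as in the next lemma, both ends move alike.
⊓-shift-< : ∀ {x μ} → x < μ → suc x ⊓ μ ≡ suc (x ⊓ μ)
⊓-shift-< x<μ = trans (m≤n⇒m⊓n≡m x<μ) (cong suc (sym (m≤n⇒m⊓n≡m (<⇒≤ x<μ))))

⊓-shift-≮ : ∀ {x μ} → ¬ x < μ → suc x ⊓ μ ≡ x ⊓ μ
⊓-shift-≮ x≮μ = trans (m≥n⇒m⊓n≡n (m≤n⇒m≤1+n (≮⇒≥ x≮μ))) (sym (m≥n⇒m⊓n≡n (≮⇒≥ x≮μ)))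

-- The edge from z to z + 1 of a segment after the step, in terms of offsets
-- before the step.
data EdgeOrigin (w μ z : ℕ) : Set where
  kept    : ∀ x → ¬ x < μ → suc x ≤ w → z ≡ x + x ⊓ μ → EdgeOrigin w μ z
  grown   : ∀ y → y < μ → z ≡ y + y → EdgeOrigin w μ z
  spliced : ∀ y → y < μ → suc y ≤ w → z ≡ suc (y + y) → EdgeOrigin w μ z

parity : ∀ z → (∃[ y ] z ≡ y + y) ⊎ (∃[ y ] z ≡ suc (y + y))
parity zero = inj₁ (0 , refl)
parity (suc z) with parity z
... | inj₁ (y , refl) = inj₂ (y , refl)
... | inj₂ (y , refl) = inj₁ (suc y , cong suc (sym (+-suc y y)))

half-< : ∀ {y μ} → y + y < μ + μ → y < μ
half-< {y} {μ} lt = ≰⇒> (λ μ≤y → <⇒≱ lt (+-mono-≤ μ≤y μ≤y))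

-- Up to offset 2 μ old and generated nodes alternate, so the parity of z tells a `grown` edge from
-- a `spliced` one; from 2 μ on the segment is merely translated by μ and its edges are `kept`. The
-- bound by 2 w + 1 ensures that the old nodes named are present: when μ = w + 1, no edge starts at
-- the generated tip.
edgeOrigin : ∀ {w len z} → suc z ≤ len → suc z ≤ suc (w + w) → EdgeOrigin w (quota w len) z
edgeOrigin {w} {len} {z} z<len z<cap with z <? quota w len + quota w len | parity z
... | yes lt | inj₁ (y , refl) = grown y (half-< lt) refl
... | yes lt | inj₂ (y , refl) = spliced y (half-< (<-trans (n<1+n _) lt)) (half-< y+y<w+w) refl
  where
  y+y<w+w : y + y < w + w
  y+y<w+w = ≤-pred z<cap
... | no ≮ | _ = kept (z ∸ μ) (≤⇒≯ μ≤x) x<w z≡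
  where
  μ = quota w len
  μ+μ≤z : μ + μ ≤ z
  μ+μ≤z = ≮⇒≥ ≮
  μ≤x : μ ≤ z ∸ μ
  μ≤x = m+n≤o⇒m≤o∸n μ μ+μ≤z
  μ≤z : μ ≤ z
  μ≤z = ≤-trans (m≤m+n μ μ) μ+μ≤z
  x<w : suc (z ∸ μ) ≤ w
  x<w = +-cancelˡ-≤ μ _ _ (≤-trans
    (≤-reflexive (trans (+-suc μ _) (cong suc (m+[n∸m]≡n μ≤z)))) (≤quota+w w len z<len z<cap))
  z≡ : z ≡ (z ∸ μ) + (z ∸ μ) ⊓ μ
  z≡ = sym (trans (cong (_+_ (z ∸ μ)) (m≥n⇒m⊓n≡n μ≤x)) (m∸n+n≡m μ≤z))

-- Caps and the number of doublings in a phase.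

double : Dir → (Dir → ℕ) → Dir → ℕ
double d cap e = if does (e ≟ᵈ d) then suc (cap d + cap d) else cap e

double-same : ∀ d cap → double d cap d ≡ suc (cap d + cap d)
double-same d cap = cong (if_then suc (cap d + cap d) else cap d) (dec-true (d ≟ᵈ d) refl)

double-other : ∀ d cap {e} → e ≢ d → double d cap e ≡ cap e
double-other d cap {e} e≢d = cong (if_then suc (cap d + cap d) else cap e) (dec-false (e ≟ᵈ d) e≢d)

double-increasing : ∀ d cap e → cap e ≤ double d cap e
double-increasing d cap e with e ≟ᵈ d
... | yes refl = ≤-trans (m≤n⇒m≤1+n (m≤m+n (cap d) (cap d))) (≤-reflexive (sym (double-same d cap)))
... | no  e≢d  = ≤-reflexive (sym (double-other d cap e≢d))

doubles : ℕ → Dir → (Dir → ℕ) → Dir → ℕ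
doubles zero    d cap = cap
doubles (suc n) d cap = doubles n d (double d cap)

doubles-increasing : ∀ n d cap e → cap e ≤ doubles n d cap e
doubles-increasing zero    d cap e = ≤-refl
doubles-increasing (suc n) d cap e = ≤-trans (double-increasing d cap e) (doubles-increasing n d (double d cap) e)

-- What doubles exactly is the cap plus one, the count that includes the base.
doubles-power : ∀ n d cap → 2 ^ n * suc (cap d) ≡ suc (doubles n d cap d)
doubles-power zero    d cap = +-identityʳ _
doubles-power (suc n) d cap = begin
  2 * 2 ^ n * suc (cap d)          ≡⟨ ring (2 ^ n) (cap d) ⟩
  2 ^ n * suc (suc (cap d + cap d)) ≡⟨ cong (λ c → 2 ^ n * suc c) (double-same d cap) ⟨
  2 ^ n * suc (double d cap d)     ≡⟨ doubles-power n d (double d cap) ⟩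
  suc (doubles (suc n) d cap d)    ∎
  where
  open ≡-Reasoning
  ring : ∀ p c → 2 * p * suc c ≡ p * suc (suc (c + c))
  ring = ℕ-Solver.solve-∀

doubles-large : ∀ {N} n → N < 2 ^ n → ∀ d cap → N ≤ doubles n d cap d
doubles-large n N< d cap = ≤-pred (begin
  suc _                     ≤⟨ N< ⟩
  2 ^ n                     ≤⟨ m≤m*n (2 ^ n) (suc (cap d)) ⟩
  2 ^ n * suc (cap d)       ≡⟨ doubles-power n d cap ⟩
  suc (doubles n d cap d)   ∎)
  where open ≤-Reasoning

none : Dir → ℕ
none _ = 0

allDirs : ℕ → Dir → ℕ
allDirs L = doubles L west (doubles L south (doubles L east (doubles L north none)))

allDirs-large : ∀ {N} L → N < 2 ^ L → ∀ d → N ≤ allDirs L d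
allDirs-large L N< = λ
  { north → ≤-trans (doubles-large L N< north none) (≤-trans (doubles-increasing L east _ north)
              (≤-trans (doubles-increasing L south _ north) (doubles-increasing L west _ north)))
  ; east  → ≤-trans (doubles-large L N< east _)
              (≤-trans (doubles-increasing L south _ east) (doubles-increasing L west _ east))
  ; south → ≤-trans (doubles-large L N< south _) (doubles-increasing L west _ south)
  ; west  → doubles-large L N< west _ }

n<2^[1+log₂n] : ∀ n → n < 2 ^ suc ⌊log₂ n ⌋
n<2^[1+log₂n] n = ≰⇒> λ le → 1+n≰n (≤-trans (≤-reflexive (sym (⌊log₂[2^n]⌋≡n _))) (⌊log₂⌋-mono-≤ le))

-- Simple paths and walks in a shape.

Unique-length-≤ : {A : Set} {xs ys : List A} → Unique xs → xs ⊆ ys → length xs ≤ length ys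
Unique-length-≤ {xs = []} _ _ = z≤n
Unique-length-≤ {xs = x ∷ xs} (x∉ ∷ u) xs⊆ys with ∈-∃++ (xs⊆ys (here refl))
... | ys₁ , ys₂ , refl = ≤-trans (s≤s (Unique-length-≤ u rest)) (≤-reflexive count)
  where
  rest : xs ⊆ ys₁ ++ ys₂
  rest z∈xs with ∈-++⁻ ys₁ (xs⊆ys (there z∈xs))
  ... | inj₁ z∈ys₁         = ∈-++⁺ˡ z∈ys₁
  ... | inj₂ (here refl)   = contradiction refl (All.lookup x∉ z∈xs)
  ... | inj₂ (there z∈ys₂) = ∈-++⁺ʳ ys₁ z∈ys₂
  count : suc (length (ys₁ ++ ys₂)) ≡ length (ys₁ ++ x ∷ ys₂)
  count = trans (cong suc (length-++ ys₁)) (trans (sym (+-suc (length ys₁) _)) (sym (length-++ ys₁)))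

module _ {S : Shape} where

  open Shape S using (_~_; ~-sym; ~-node)

  path-head : ∀ {a b ps} → Path S a b ps → ∃[ qs ] ps ≡ b ∷ qs
  path-head start          = [] , refl
  path-head (extend _ _ _) = _ , refl

  path-head-≡ : ∀ {a b c ps} → Path S a b (c ∷ ps) → b ≡ c
  path-head-≡ start          = refl
  path-head-≡ (extend _ _ _) = refl

  path-end-unique : ∀ {a b c ps} → Path S a b ps → Path S a c ps → b ≡ c
  path-end-unique p q with _ , refl ← path-head q = path-head-≡ p

  path-end∈ : ∀ {a b ps} → Path S a b ps → b ∈ ps
  path-end∈ p with _ , refl ← path-head p = here refl

  path-start∈ : ∀ {a b ps} → Path S a b ps → a ∈ ps
  path-start∈ start          = here refl
  path-start∈ (extend p _ _) = there (path-start∈ p)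

  path-nodes : ∀ {a b ps} → a ∈ Shape.nodes S → Path S a b ps → ps ⊆ Shape.nodes S
  path-nodes a∈ start          (here refl) = a∈
  path-nodes a∈ (extend p e _) (here refl) = ~-node (~-sym e)
  path-nodes a∈ (extend p _ _) (there q∈)  = path-nodes a∈ p q∈

  path-unique-nodes : ∀ {a b ps} → Path S a b ps → Unique ps
  path-unique-nodes start          = [] ∷ []
  path-unique-nodes (extend p _ n) = ¬Any⇒All¬ _ n ∷ path-unique-nodes p

  -- Supplies the fuel for the recursions that lengthen a path until it is stuck.
  path-length : ∀ {a b ps} → a ∈ Shape.nodes S → Path S a b ps → length ps ≤ Shape.size S
  path-length a∈ p = Unique-length-≤ (path-unique-nodes p) (path-nodes a∈ p)

  path-tail : ∀ {a b c p ps} → Path S a c (b ∷ p ∷ ps) → Path S a p (p ∷ ps) × p ~ c × c ∉ p ∷ ps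
  path-tail (extend q e n) with refl ← path-head-≡ q = q , e , n

  truncate : ∀ {a b c ps} → Path S a b ps → c ∈ ps → ∃[ qs ] Path S a c qs × qs ⊆ ps
  truncate start            (here refl) = _ , start , λ q∈ → q∈
  truncate p@(extend _ _ _) (here refl) = _ , p , λ q∈ → q∈
  truncate (extend p _ _)   (there c∈) with truncate p c∈
  ... | qs , q , qs⊆ps = qs , q , there ∘ qs⊆ps

  Inside : Pred Point 0ℓ → Rel Point 0ℓ
  Inside P p q = p ~ q × P p × P q

  -- The walk is followed edge by edge, and whenever it returns to a node of the path built so far,
  -- the path is cut back to that node. Carrying `P` along allows paths that avoid a prescribed
  -- node.
  loopErase : ∀ {P a b c ps} → Path S a b ps → All P ps → Star (Inside P) b c →
              ∃[ qs ] Path S a c qs × All P qs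
  loopErase p all ε = _ , p , all
  loopErase {ps = ps} p all (_◅_ {j = q} (e , _ , Pq) es) with q ∈? ps
  ... | no  q∉ps = loopErase (extend p e q∉ps) (Pq ∷ all) es
  ... | yes q∈ps with truncate p q∈ps
  ...   | _ , p′ , qs⊆ps = loopErase p′ (All.tabulate (All.lookup all ∘ qs⊆ps)) es

  walk : ∀ {P a b ps} → Path S a b ps → All P ps → Star (Inside P) a b
  walk start          _         = ε
  walk (extend p e _) (Pc ∷ all) = walk p all ◅◅ ((e , All.lookup all (path-end∈ p) , Pc) ◅ ε)

  walk⁻¹ : ∀ {P a b} → Star (Inside P) a b → Star (Inside P) b a
  walk⁻¹ = Star.reverse (λ (e , Pp , Pq) → ~-sym e , Pq , Pp)

-- Segment counts, last runs and straight ends of paths.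

segments-mono : ∀ c p ps → segments (p ∷ ps) ≤ segments (c ∷ p ∷ ps)
segments-mono c p []       = z≤n
segments-mono c p (q ∷ ps) = s≤s (m≤n+m _ _)

segments-straight : ∀ {c p q} ps → ¬ Perpendicular c p q →
                    segments (c ∷ p ∷ q ∷ ps) ≡ segments (p ∷ q ∷ ps)
segments-straight {c} {p} {q} ps ¬perp =
  cong (λ b → suc ((if b then 1 else 0) + innerTurns (p ∷ q ∷ ps))) (dec-false (perpendicular? c p q) ¬perp)

segments-turn : ∀ {c p q} ps → Perpendicular c p q →
                segments (c ∷ p ∷ q ∷ ps) ≡ suc (segments (p ∷ q ∷ ps))
segments-turn {c} {p} {q} ps perp =
  cong (λ b → suc ((if b then 1 else 0) + innerTurns (p ∷ q ∷ ps))) (dec-true (perpendicular? c p q) perp)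

-- The number of edges in the last segment of a path.
run : List Point → ℕ
run (c ∷ p ∷ ps) =
  if does (segments (c ∷ p ∷ ps) ℕ.≟ segments (p ∷ ps)) then suc (run (p ∷ ps)) else 1
run _ = 0

dirOf : List Point → Dir
dirOf (c ∷ p ∷ ps) = toDir (c ⊖ p)
dirOf _            = north

run≤length : ∀ ps → run ps ≤ length ps
run≤length []           = z≤n
run≤length (_ ∷ [])     = z≤n
run≤length (c ∷ p ∷ ps) =
  bound (does (segments (c ∷ p ∷ ps) ℕ.≟ segments (p ∷ ps))) (run≤length (p ∷ ps))
  where
  bound : ∀ b {m n} → m ≤ n → (if b then suc m else 1) ≤ suc n
  bound true  m≤n = s≤s m≤n
  bound false _   = s≤s z≤n

run≡0⇒segments≡0 : ∀ ps → run ps ≡ 0 → segments ps ≡ 0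
run≡0⇒segments≡0 []           _ = refl
run≡0⇒segments≡0 (_ ∷ [])     _ = refl
run≡0⇒segments≡0 (c ∷ p ∷ ps) eq =
  ⊥-elim (positive (does (segments (c ∷ p ∷ ps) ℕ.≟ segments (p ∷ ps))) eq)
  where
  positive : ∀ b {m} → (if b then suc m else 1) ≢ 0
  positive true  ()
  positive false ()

length-line : ∀ b d x → length (line b d x) ≡ x
length-line b d zero    = refl
length-line b d (suc x) = cong suc (length-line b d x)

∈-line⁻ : ∀ {u} b d m → u ∈ line b d m → ∃[ x ] x ≤ m × u ≡ at b d x
∈-line⁻ b d (suc m) (here refl) = suc m , ≤-refl , refl
∈-line⁻ b d (suc m) (there u∈) with ∈-line⁻ b d m u∈
... | x , x≤m , eq = x , m≤n⇒m≤1+n x≤m , eq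

∈-line⁺ : ∀ b d m {x} → suc x ≤ m → at b d (suc x) ∈ line b d m
∈-line⁺ b d (suc m) {x} (s≤s x≤m) with m≤n⇒m<n∨m≡n x≤m
... | inj₁ x<m  = there (∈-line⁺ b d m x<m)
... | inj₂ refl = here refl

-- Leaving b toward d opens a new segment. Counting segments instead of asking for a right angle
-- also covers the root, where there is no previous edge.
Turn : Point → Dir → List Point → Set
Turn b d qs = segments (line b d 1 ++ b ∷ qs) ≡ suc (segments (b ∷ qs))

turn-no-return : ∀ b d qs → Turn b d (at b d 1 ∷ qs) → ⊥
turn-no-return b d qs turn = 1+n≢n (trans (sym turn) (segments-straight qs straight))
  where
  straight : ¬ Perpendicular (at b d 1) b (at b d 1)
  straight = subst (λ p → ¬ Perpendicular p b p) (sym (at-one b d)) (¬perpendicular-back b d)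

module _ (b : Point) (d : Dir) (qs : List Point) where

  private
    before = b ∷ qs

  line-head : ∀ x → ∃[ rs ] line b d x ++ before ≡ at b d x ∷ rs
  line-head zero    = qs , cong (_∷ qs) (sym (at-zero b d))
  line-head (suc x) = _ , refl

  segments-line-suc : ∀ x → segments (line b d (2 + x) ++ before) ≡ segments (line b d (1 + x) ++ before)
  segments-line-suc x with line-head x
  ... | rs , eq rewrite eq = segments-straight rs straight
    where
    straight : ¬ Perpendicular (at b d (2 + x)) (at b d (1 + x)) (at b d x)
    straight = subst₂ (λ c p → ¬ Perpendicular c p (at b d x))
      (sym (trans (at-suc b d (suc x)) (cong (_⊕ vec d) (at-suc b d x)))) (sym (at-suc b d x))
      (¬perpendicular-line (at b d x) d)

  segments-line-first : ∀ x → segments (line b d (suc x) ++ before) ≡ segments (line b d 1 ++ before)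
  segments-line-first zero    = refl
  segments-line-first (suc x) = trans (segments-line-suc x) (segments-line-first x)

  dirOf-line : ∀ x → dirOf (line b d (suc x) ++ before) ≡ d
  dirOf-line x with line-head x
  ... | rs , eq rewrite eq =
    trans (cong toDir (trans (cong (_⊖ at b d x) (at-suc b d x)) (⊕-⊖-cancel (at b d x) (vec d))))
      (toDir-vec d)

  module _ (turn : Turn b d qs) where

    segments-line : ∀ x → segments (line b d (suc x) ++ before) ≡ suc (segments before)
    segments-line x = trans (segments-line-first x) turn

    run-line : ∀ x → run (line b d (suc x) ++ before) ≡ suc x
    run-line zero =
      cong (if_then suc (run before) else 1)
        (dec-false (segments (at b d 1 ∷ before) ℕ.≟ segments before)
          (λ eq → 1+n≢n (trans (sym turn) eq)))
    run-line (suc x) =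
      trans (cong (if_then suc (run ps) else 1)
              (dec-true (segments (at b d (2 + x) ∷ ps) ℕ.≟ segments ps) (segments-line-suc x)))
        (cong suc (run-line x))
      where ps = line b d (suc x) ++ before

    -- Rules out that the next point of the line is the parent of its current end, so a tree edge to
    -- that point must lead to a child.
    line-no-return : ∀ x {p rs} → line b d x ++ before ≢ p ∷ at b d (suc x) ∷ rs
    line-no-return zero    {rs = rs} eq = turn-no-return b d rs (subst (Turn b d) (∷-injectiveʳ eq) turn)
    line-no-return (suc x) eq with line-head x
    ... | _ , eq′ = at-two-≢ b d x (∷-injectiveˡ (trans (sym eq′) (∷-injectiveʳ eq)))

line-cancel : ∀ b b′ d x {ps qs} → line b d x ++ ps ≡ line b′ d x ++ qs → ps ≡ qs
line-cancel b b′ d zero    eq = eq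
line-cancel b b′ d (suc x) eq = line-cancel b b′ d x (∷-injectiveʳ eq)

-- Root paths in a tree.

module Tree (T : Shape) (tree : IsTree T) (u₀ : Point) (u₀∈ : u₀ ∈ Shape.nodes T) where

  open Shape T using (_~_; _~?_; ~-sym; ~-node; ~-adjacent)

  RootPath : Point → List Point → Set
  RootPath = Path T u₀

  path-to : ∀ {v} → v ∈ Shape.nodes T → ∃[ ps ] RootPath v ps
  path-to v∈ with loopErase start (tt ∷ []) (Star.map (λ e → e , tt , tt) (Shape.connected T u₀∈ v∈))
  ... | ps , p , _ = ps , p

  -- If two paths enter c from different neighbours, going back along one and out along the other
  -- joins these neighbours without c. Loop erasure makes this a simple path, which closes to a
  -- cycle through c.
  path-unique : ∀ {v ps qs} → RootPath v ps → RootPath v qs → ps ≡ qs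
  path-unique start start = refl
  path-unique start (extend q _ n) = contradiction (path-start∈ q) n
  path-unique (extend p _ n) start = contradiction (path-start∈ p) n
  path-unique {c} (extend {b} {ps = ps} p e n) (extend {b′} {ps = qs} q e′ n′) with b ≟ b′
  ... | yes refl = cong (c ∷_) (path-unique p q)
  ... | no b≢b′ = ⊥-elim (cycle around)
    where
    Avoids : Pred Point 0ℓ
    Avoids v = c ≢ v
    around : ∃[ rs ] Path T b b′ rs × All Avoids rs
    around = loopErase start (All.lookup (¬Any⇒All¬ _ n) (path-end∈ p) ∷ [])
      (walk⁻¹ {S = T} (walk p (¬Any⇒All¬ _ n)) ◅◅ walk q (¬Any⇒All¬ _ n′))
    cycle : ∃[ rs ] Path T b b′ rs × All Avoids rs → ⊥
    cycle (_ , start , _) = b≢b′ refl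
    cycle (_ , r@(extend r′ _ _) , avoids) with _ , refl ← path-head r′ =
      tree (extend r e′ (All¬⇒¬Any avoids)) (s≤s (s≤s (s≤s z≤n))) (~-sym e)

  -- A neighbour already on the root path must be the parent: the path truncated there and extended
  -- by the edge is again a root path of p, so uniqueness applies.
  neighbour : ∀ {p q ps} → RootPath p ps → p ~ q →
              RootPath q (q ∷ ps) ⊎ (∃[ qs ] ps ≡ p ∷ qs × RootPath q qs)
  neighbour {p} {q} {ps} path e with q ∈? ps
  ... | no  q∉ps = inj₁ (extend path e q∉ps)
  ... | yes q∈ps = inj₂ (parent path q∈ps)
    where
    q≢p : q ≢ p
    q≢p refl with () ← trans (sym (~-adjacent e)) (manhattan-refl q)
    parent : ∀ {ps} → RootPath p ps → q ∈ ps → ∃[ qs ] ps ≡ p ∷ qs × RootPath q qs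
    parent start (here q≡p) = contradiction q≡p q≢p
    parent (extend _ _ _) (here q≡p) = contradiction q≡p q≢p
    parent path@(extend path′ _ p∉) (there q∈) with truncate path′ q∈
    ... | qs , path″ , qs⊆ = qs , path-unique path (extend path″ (~-sym e) (p∉ ∘ qs⊆)) , path″

  -- Exhibits the last segment together with the turn that opens it, the form in which `segments`,
  -- `run` and `dirOf` can be evaluated.
  data Decomposition (ps : List Point) : Set where
    root : ps ≡ u₀ ∷ [] → Decomposition ps
    lastRun  : ∀ b d qs x → RootPath b (b ∷ qs) → Turn b d qs → ps ≡ line b d (suc x) ++ b ∷ qs →
           Decomposition ps

  decompose : ∀ {v ps} → RootPath v ps → Decomposition ps
  decompose start = root refl
  decompose (extend {p} {c} {ps} path e c∉) with adjacent-dir p c (~-adjacent e) | decompose path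
  ... | d , refl | root refl with refl ← path-head-≡ path =
    lastRun u₀ d [] 0 start refl (cong (_∷ _) (sym (at-one u₀ d)))
  ... | d , refl | lastRun b d′ qs x base turn refl
    with refl ← path-head-≡ path | line-head b d′ qs x | compareDir d d′
  ...   | _ | same refl = lastRun b d qs (suc x) base turn (cong (_∷ ps) (sym (at-suc b d (suc x))))
  ...   | rs , eq | opposite opp =
    contradiction (there (subst (_ ∈_) (sym eq) (here back))) c∉
    where
    back : at b d′ (suc x) ⊕ vec d ≡ at b d′ x
    back = trans (cong (_⊕ vec d) (at-suc b d′ x)) (⊕-opposite d d′ opp (at b d′ x))
  ...   | rs , eq | perpendicular perp =
    lastRun p d _ 0 path turn′ (cong (_∷ ps) (sym (at-one p d)))
    where
    turn′ : Turn p d (line b d′ x ++ b ∷ qs)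
    turn′ rewrite eq = segments-turn rs
      (subst₂ (λ c p → Perpendicular c p (at b d′ x))
        (sym (trans (at-one p d) (cong (_⊕ vec d) (at-suc b d′ x)))) (sym (at-suc b d′ x))
        (trans (dot-steps (at b d′ x) d d′) perp))

  straight-tail : ∀ {b d qs x} → RootPath (at b d (suc x)) (line b d (suc x) ++ b ∷ qs) →
                  RootPath (at b d x) (line b d x ++ b ∷ qs) × at b d x ~ at b d (suc x)
  straight-tail {b} {d} {qs} {x} path with line-head b d qs x
  ... | rs , eq with path-tail (subst (λ ps → RootPath _ (at b d (suc x) ∷ ps)) eq path)
  ...   | path′ , e , _ = subst (RootPath _) (sym eq) path′ , e

  straight-prefix : ∀ {b d qs x y} → y ≤ x → RootPath (at b d x) (line b d x ++ b ∷ qs) →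
                    RootPath (at b d y) (line b d y ++ b ∷ qs)
  straight-prefix {x = x} y≤x path with m≤n⇒m<n∨m≡n y≤x
  straight-prefix y≤x path | inj₂ refl = path
  straight-prefix {x = suc x} y≤x path | inj₁ (s≤s y≤x′) = straight-prefix y≤x′ (proj₁ (straight-tail path))

  -- Maximal segments of a given distance and direction.

  module _ (j : ℕ) (d : Dir) where

    -- A maximal segment at distance suc j; unlike a Segment it may have length 0.
    record Chain : Set where
      field
        base    : Point
        behind  : List Point
        len     : ℕ
        route   : RootPath (at base d len) (line base d len ++ base ∷ behind)
        dist    : segments (base ∷ behind) ≡ j
        turn    : Turn base d behind
        maximal : ¬ (at base d len ~ at base d (suc len))

      pt : ℕ → Point
      pt = at base d

      pathList : ℕ → List Point
      pathList x = line base d x ++ base ∷ behind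

      path : ∀ {x} → x ≤ len → RootPath (pt x) (pathList x)
      path x≤len = straight-prefix x≤len route

      edge : ∀ {x} → suc x ≤ len → pt x ~ pt (suc x)
      edge x<len = proj₂ (straight-tail (path x<len))

      path⇒≤len : ∀ {x} → RootPath (pt x) (pathList x) → x ≤ len
      path⇒≤len {x} p with x ≤? len
      ... | yes x≤len = x≤len
      ... | no  x≰len = contradiction (proj₂ (straight-tail (straight-prefix (≰⇒> x≰len) p))) maximal

      segments-suc : ∀ x → segments (pathList (suc x)) ≡ suc j
      segments-suc x = trans (segments-line base d behind turn x) (cong suc dist)

      dirOf-suc : ∀ x → dirOf (pathList (suc x)) ≡ d
      dirOf-suc = dirOf-line base d behind

      run-suc : ∀ x → run (pathList (suc x)) ≡ suc x
      run-suc = run-line base d behind turn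

    open Chain

    -- The line is prolonged while `T` has the next edge; each prolongation is a longer root path,
    -- so this stops within the size of `T`.
    completeChain : ∀ {b qs} → segments (b ∷ qs) ≡ j → Turn b d qs →
      ∀ x → RootPath (at b d x) (line b d x ++ b ∷ qs) →
      ∃[ C ] base C ≡ b × x ≤ len C
    completeChain {b} {qs} dist turn x p = go (Shape.size T) x p (m≤n+m _ x)
      where
      go : ∀ fuel x → RootPath (at b d x) (line b d x ++ b ∷ qs) → Shape.size T ≤ x + fuel →
           ∃[ C ] base C ≡ b × x ≤ len C
      go fuel x p bound with at b d x ~? at b d (suc x)
      ... | no maximal = record { route = p ; dist = dist ; turn = turn ; maximal = maximal } , refl , ≤-refl
      ... | yes e with neighbour p e
      ...   | inj₂ (rs , eq , q) with _ , refl ← path-head q =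
        contradiction eq (line-no-return b d qs turn x)
      go zero x p bound | yes e | inj₁ _ = contradiction (path-length u₀∈ p) (<⇒≱ (begin-strict
        Shape.size T                      ≤⟨ bound ⟩
        x + 0                             <⟨ +-monoʳ-< x (s≤s z≤n) ⟩
        x + length (b ∷ qs)               ≡⟨ cong (_+ length (b ∷ qs)) (length-line b d x) ⟨
        length (line b d x) + length (b ∷ qs) ≡⟨ length-++ (line b d x) ⟨
        length (line b d x ++ b ∷ qs)     ∎))
        where open ≤-Reasoning
      go (suc fuel) x p bound | yes e | inj₁ p′
        with go fuel (suc x) p′ (subst (Shape.size T ≤_) (+-suc x fuel) bound)
      ...   | C , eq , le = C , eq , <⇒≤ le

    -- Both chains describe the unique root path of the common point. The segment count separates a
    -- base from later nodes, `run` recovers the offset, removing equally many points leaves equal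
    -- paths to the bases, and maximality equates the lengths.
    chain-unique : ∀ C C′ {x x′} → x ≤ len C → x′ ≤ len C′ → pt C x ≡ pt C′ x′ →
                   x ≡ x′ × base C ≡ base C′ × len C ≡ len C′
    chain-unique C C′ {x} {x′} x≤ x′≤ eq = compare x x′ lists
      where
      lists : pathList C x ≡ pathList C′ x′
      lists = path-unique (path C x≤) (subst (λ p → RootPath p (pathList C′ x′)) (sym eq) (path C′ x′≤))
      longest : ∀ C C′ → base C ∷ behind C ≡ base C′ ∷ behind C′ → len C ≤ len C′
      longest C C′ eq = path⇒≤len C′ (subst₂ (λ b ps → RootPath (at b d (len C)) (line b d (len C) ++ ps))
        (∷-injectiveˡ eq) eq (route C))
      same-base : ∀ y → pathList C y ≡ pathList C′ y → y ≡ y × base C ≡ base C′ × len C ≡ len C′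
      same-base y eq = refl , ∷-injectiveˡ befores , ≤-antisym (longest C C′ befores) (longest C′ C (sym befores))
        where befores = line-cancel (base C) (base C′) d y eq
      compare : ∀ y y′ → pathList C y ≡ pathList C′ y′ → y ≡ y′ × base C ≡ base C′ × len C ≡ len C′
      compare zero zero eq = same-base 0 eq
      compare zero (suc y) eq = contradiction
        (trans (sym (segments-suc C′ y)) (trans (cong segments (sym eq)) (dist C))) 1+n≢n
      compare (suc y) zero eq = contradiction
        (trans (sym (segments-suc C y)) (trans (cong segments eq) (dist C′))) 1+n≢n
      compare (suc y) (suc y′) eq with trans (sym (run-suc C y)) (trans (cong run eq) (run-suc C′ y′))
      ... | refl = same-base (suc y) eq

    On : Point → Set
    On v = ∃[ C ] ∃[ x ] x ≤ len C × v ≡ pt C x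

    -- Unlike `On` this leaves out the base, which may receive an operation but is never displaced.
    Moving : Point → Set
    Moving v = ∃[ C ] ∃[ x ] suc x ≤ len C × v ≡ pt C (suc x)

    moving⁺ : ∀ {v ps} → RootPath v ps → segments ps ≡ suc j → dirOf ps ≡ d → Moving v
    moving⁺ p seg dir with decompose p
    moving⁺ p () dir | root refl
    moving⁺ p seg dir | lastRun b e qs x base turn refl
      with refl ← trans (sym (dirOf-line b e qs x)) dir | refl ← path-head-≡ p
      with completeChain (suc-injective (trans (sym (segments-line b d qs turn x)) seg)) turn (suc x) p
    ... | C , refl , le = C , x , le , refl

    moving⁻ : ∀ {v ps} → RootPath v ps → Moving v → segments ps ≡ suc j × dirOf ps ≡ d
    moving⁻ p (C , x , le , refl) with refl ← path-unique p (path C le) = segments-suc C x , dirOf-suc C x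

    -- The root path replaces a search over chains: a node beyond the base is recognised by segment
    -- count and last direction, a base by whether a step toward d would turn.
    on? : ∀ v → Dec (On v)
    on? v with v ∈? Shape.nodes T
    ... | no v∉ = no λ { (C , x , le , refl) → v∉ (path-nodes u₀∈ (path C le) (path-end∈ (path C le))) }
    ... | yes v∈ with path-to v∈
    ...   | ps , p with path-head p
    ...     | qs , refl with (segments ps ℕ.≟ suc j) ×-dec (dirOf ps ≟ᵈ d)
    ...       | yes (seg , dir) = yes (let C , x , le , eq = moving⁺ p seg dir in C , suc x , le , eq)
    ...       | no ¬moving with (segments ps ℕ.≟ j) ×-dec (segments (line v d 1 ++ ps) ℕ.≟ suc (segments ps))
    ...         | yes (dist , turn) = yes (based
      (completeChain dist turn 0 (subst (λ u → RootPath u ps) (sym (at-zero v d)) p)))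
      where
      based : ∃[ C ] base C ≡ v × 0 ≤ len C → On v
      based (C , refl , le) = C , 0 , z≤n , sym (at-zero v d)
    ...         | no ¬base = no λ
      { (C , zero , le , eq) → ¬base (base-case C eq)
      ; (C , suc x , le , eq) → ¬moving (moving⁻ p (C , x , le , eq)) }
      where
      base-case : ∀ C → v ≡ pt C 0 → segments ps ≡ j × segments (line v d 1 ++ ps) ≡ suc (segments ps)
      base-case C eq with refl ← trans eq (at-zero (base C) d)
        with refl ← path-unique p (subst (λ u → RootPath u (pathList C 0)) (at-zero v d) (path C z≤n)) =
        dist C , turn C

    moving? : ∀ v → Dec (Moving v)
    moving? v with on? v
    ... | yes (C , suc x , le , eq) = yes (C , x , le , eq)
    ... | yes (C , zero , _ , refl) = no λ (C′ , x , le , eq) →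
      contradiction (proj₁ (chain-unique C C′ z≤n le eq)) λ ()
    ... | no ¬on = no λ (C , x , le , eq) → ¬on (C , suc x , le , eq)

  -- Intermediate shapes as subtrees of `T`.

  -- The progress of phase i: the segments at distance i in direction d have
  -- been grown up to length cap d.
  Reached : ℕ → (Dir → ℕ) → List Point → Set
  Reached i cap ps = segments ps < i ⊎ (segments ps ≡ i × run ps ≤ cap (dirOf ps))

  reached? : ∀ i cap → Decidable (Reached i cap)
  reached? i cap ps = (segments ps <? i) ⊎-dec ((segments ps ℕ.≟ i) ×-dec (run ps ≤? cap (dirOf ps)))

  reached⇒≤ : ∀ i cap ps → Reached i cap ps → segments ps ≤ i
  reached⇒≤ i cap ps (inj₁ lt)       = <⇒≤ lt
  reached⇒≤ i cap ps (inj₂ (eq , _)) = ≤-reflexive eq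

  -- Closure under parents, which makes every stage connected through the root.
  reached-tail : ∀ i cap {c p ps} → RootPath c (c ∷ ps) → RootPath p ps →
                 Reached i cap (c ∷ ps) → Reached i cap ps
  reached-tail i cap {c} {ps = ps} cpath ppath r with decompose cpath
  reached-tail i cap cpath () r | root refl
  ... | lastRun b d qs zero _ turn refl = inj₁ (≤-trans (≤-reflexive (sym turn)) (reached⇒≤ i cap (c ∷ ps) r))
  ... | lastRun b d qs (suc x) _ turn refl = Sum.map
    (subst (_< i) (segments-line-suc b d qs x))
    (λ (seg , bound) → trans (sym (segments-line-suc b d qs x)) seg ,
      (begin
        run ps                     ≡⟨ run-line b d qs turn x ⟩
        suc x                      ≤⟨ n≤1+n _ ⟩
        2 + x                      ≡⟨ run-line b d qs turn (suc x) ⟨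
        run (c ∷ ps)               ≤⟨ bound ⟩
        cap (dirOf (c ∷ ps))       ≡⟨ cong cap (trans (dirOf-line b d qs (suc x)) (sym (dirOf-line b d qs x))) ⟩
        cap (dirOf ps)             ∎)) r
    where open ≤-Reasoning

  Reach : (List Point → Set) → Point → Set
  Reach R v = ∃[ ps ] RootPath v ps × R ps

  -- Unfolds to `GrownUpTo T u₀ i` when `R ps` is `segments ps ≤ i`, so one notion serves both
  -- inside a phase and between phases.
  Grown : (List Point → Set) → Shape → Set
  Grown R S = (∀ p → p ∈ Shape.nodes S ⇔ Reach R p) ×
              (∀ p q → Shape._~_ S p q ⇔ (p ~ q × Reach R p × Reach R q))

  reach-path : ∀ {R v ps} → RootPath v ps → Reach R v → R ps
  reach-path p (_ , q , r) with refl ← path-unique p q = r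

  reach-node : ∀ {R v} → Reach R v → v ∈ Shape.nodes T
  reach-node (_ , p , _) = path-nodes u₀∈ p (path-end∈ p)

  reach? : ∀ {R} → Decidable R → Decidable (Reach R)
  reach? R? v with v ∈? Shape.nodes T
  ... | no  v∉ = no (v∉ ∘ reach-node)
  ... | yes v∈ with path-to v∈
  ...   | ps , p = map′ (λ r → ps , p , r) (reach-path p) (R? ps)

  module _ (i : ℕ) (cap : Dir → ℕ) where

    private
      R = Reached (suc i) cap
      _~′_ : Point → Point → Set
      p ~′ q = p ~ q × Reach R p × Reach R q

      ~′-sym : ∀ {p q} → p ~′ q → q ~′ p
      ~′-sym (e , rp , rq) = ~-sym e , rq , rp

      from-root : ∀ {v ps} → RootPath v ps → R ps → Star _~′_ u₀ v
      from-root start _ = ε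
      from-root path@(extend p e _) r = from-root p r′ ◅◅ (e , (_ , p , r′) , (_ , path , r)) ◅ ε
        where r′ = reached-tail (suc i) cap path p r

    stage : Shape
    stage = record
      { nodes      = filter (reach? (reached? (suc i) cap)) (Shape.nodes T)
      ; distinct   = Unique.filter⁺ (reach? (reached? (suc i) cap)) (Shape.distinct T)
      ; _~_        = _~′_
      ; _~?_       = λ p q → (p ~? q) ×-dec (reach? (reached? (suc i) cap) p ×-dec reach? (reached? (suc i) cap) q)
      ; ~-sym      = ~′-sym
      ; ~-node     = λ (e , rp , _) → ∈-filter⁺ (reach? (reached? (suc i) cap)) (~-node e) rp
      ; ~-adjacent = ~-adjacent ∘ proj₁
      ; connected  = λ p∈ q∈ → Star.reverse ~′-sym (connect p∈) ◅◅ connect q∈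
      }
      where
      connect : ∀ {v} → v ∈ filter (reach? (reached? (suc i) cap)) (Shape.nodes T) → Star _~′_ u₀ v
      connect v∈ with ∈-filter⁻ (reach? (reached? (suc i) cap)) {xs = Shape.nodes T} v∈
      ... | _ , _ , p , r = from-root p r

    stage-grown : Grown R stage
    stage-grown = (λ p → mk⇔ (λ p∈ → proj₂ (∈-filter⁻ (reach? (reached? (suc i) cap)) {xs = Shape.nodes T} p∈))
                             (λ r → ∈-filter⁺ (reach? (reached? (suc i) cap)) (reach-node r) r))
                , (λ p q → mk⇔ (λ e → e) (λ e → e))

  -- A single step, advancing all segments of direction d.

  module DoublingStep (j : ℕ) (d : Dir) (cap cap′ : Dir → ℕ)
    (doubled : cap′ d ≡ suc (cap d + cap d)) (unchanged : ∀ {e} → e ≢ d → cap′ e ≡ cap e) where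

    open Chain

    w = cap d
    R R′ : List Point → Set
    R  = Reached (suc j) cap
    R′ = Reached (suc j) cap′

    Seg = Chain j d
    Mov = Moving j d

    reached-chain⁺ : ∀ cap (C : Seg) x → x ≤ cap d → Reached (suc j) cap (pathList C x)
    reached-chain⁺ cap C zero    _  = inj₁ (s≤s (≤-reflexive (dist C)))
    reached-chain⁺ cap C (suc x) le = inj₂ (segments-suc C x ,
      ≤-trans (≤-reflexive (run-suc C x)) (≤-trans le (≤-reflexive (cong cap (sym (dirOf-suc C x))))))

    reached-chain⁻ : ∀ cap (C : Seg) x → Reached (suc j) cap (pathList C x) → x ≤ cap d
    reached-chain⁻ cap C zero    _ = z≤n
    reached-chain⁻ cap C (suc x) (inj₁ lt) = contradiction (segments-suc C x) (<⇒≢ lt)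
    reached-chain⁻ cap C (suc x) (inj₂ (_ , le)) =
      ≤-trans (≤-reflexive (sym (run-suc C x))) (≤-trans le (≤-reflexive (cong cap (dirOf-suc C x))))

    reach-chain⁺ : ∀ cap (C : Seg) {x} → x ≤ len C → x ≤ cap d → Reach (Reached (suc j) cap) (pt C x)
    reach-chain⁺ cap C {x} le le′ = _ , path C le , reached-chain⁺ cap C x le′

    reach-chain⁻ : ∀ (C : Seg) {x} → x ≤ len C → Reach R (pt C x) → x ≤ w
    reach-chain⁻ C {x} le r = reached-chain⁻ cap C x (reach-path (path C le) r)

    reached-still : ∀ {cap cap′ v ps} → (∀ {e} → e ≢ d → cap′ e ≡ cap e) → ¬ Mov v → RootPath v ps →
                    Reached (suc j) cap ps → Reached (suc j) cap′ ps
    reached-still agree ¬mv p (inj₁ lt) = inj₁ lt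
    reached-still {ps = ps} agree ¬mv p (inj₂ (seg , le)) with dirOf ps ≟ᵈ d
    ... | yes eq = contradiction (moving⁺ j d p seg eq) ¬mv
    ... | no  ne = inj₂ (seg , ≤-trans le (≤-reflexive (sym (agree ne))))

    reach-still⁺ : ∀ {v} → ¬ Mov v → Reach R v → Reach R′ v
    reach-still⁺ ¬mv (ps , p , r) = ps , p , reached-still unchanged ¬mv p r

    reach-still⁻ : ∀ {v} → ¬ Mov v → Reach R′ v → Reach R v
    reach-still⁻ ¬mv (ps , p , r) = ps , p , reached-still (sym ∘ unchanged) ¬mv p r

    data EdgeView (p c : Point) : Set where
      along : ∀ (C : Seg) x → suc x ≤ len C → p ≡ pt C x → c ≡ pt C (suc x) → EdgeView p c
      still : ¬ Mov p → ¬ Mov c → EdgeView p c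

    -- The bound excludes edges leaving a chain sideways, whose far ends have distance j + 2. Hence
    -- a child of a moving node lies on the same chain.
    edgeView : ∀ {p c ps} → RootPath p ps → RootPath c (c ∷ ps) → segments (c ∷ ps) ≤ suc j → EdgeView p c
    edgeView {p} {c} {ps} ppath cpath bound with moving? j d c
    ... | yes (C , x , le , refl) with refl ← path-unique cpath (path C le) =
      along C x le (path-end-unique ppath (path C (<⇒≤ le))) refl
    ... | no ¬mc = still ¬mp ¬mc
      where
      ¬mp : ¬ Mov p
      ¬mp mp with moving⁻ j d ppath mp | decompose cpath
      ... | () , _ | root refl
      ... | seg , _ | lastRun b e qs zero _ turn refl =
        <⇒≱ (≤-reflexive (sym (trans turn (cong suc seg)))) bound
      ... | seg , dir | lastRun b e qs (suc x) _ turn refl = ¬mc (moving⁺ j d cpath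
        (trans (segments-line-suc b e qs x) seg)
        (trans (dirOf-line b e qs (suc x)) (trans (sym (dirOf-line b e qs x)) dir)))

    μ : Seg → ℕ
    μ C = quota w (len C)

    Op : Point → Set
    Op u = ∃[ C ] ∃[ y ] y < μ C × u ≡ pt C y

    μ-cong : ∀ (C C′ : Seg) → len C ≡ len C′ → μ C ≡ μ C′
    μ-cong _ _ = cong (quota w)

    op-chain : ∀ (C : Seg) {x} → x ≤ len C → Op (pt C x) → x < μ C
    op-chain C le (C′ , y , lt , eq) with chain-unique j d C C′ le (<quota⇒≤len w (len C′) lt) eq
    ... | refl , _ , len≡ = ≤-trans lt (≤-reflexive (μ-cong C′ C (sym len≡)))

    op? : Decidable Op
    op? u with on? j d u
    ... | no ¬on = no λ (C , y , lt , eq) → ¬on (C , y , <quota⇒≤len w (len C) lt , eq)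
    ... | yes (C , x , le , refl) = map′ (λ lt → C , x , lt , refl) (op-chain C le) (x <? μ C)

    -- `Step` asks for a function on points, so the offset is taken from whichever chain `on?`
    -- returns; by `chain-unique` the choice does not matter.
    δ : Point → ℕ
    δ v with on? j d v
    ... | yes (C , x , _) = x ⊓ μ C
    ... | no _            = 0

    δ-chain : ∀ (C : Seg) {x} → x ≤ len C → δ (pt C x) ≡ x ⊓ μ C
    δ-chain C {x} le with on? j d (pt C x)
    ... | no ¬on = contradiction (C , x , le , refl) ¬on
    ... | yes (C′ , x′ , le′ , eq) with chain-unique j d C C′ le le′ eq
    ...   | refl , _ , len≡ = cong (x ⊓_) (μ-cong C′ C (sym len≡))

    δ-still : ∀ {v} → ¬ Mov v → δ v ≡ 0
    δ-still {v} ¬mv with on? j d v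
    ... | no _ = refl
    ... | yes (C , zero , _) = refl
    ... | yes (C , suc x , le , eq) = contradiction (C , x , le , eq) ¬mv

    move : Point → Point
    move v = at v d (δ v)

    move-chain : ∀ (C : Seg) {x} → x ≤ len C → move (pt C x) ≡ pt C (x + x ⊓ μ C)
    move-chain C {x} le = trans (cong (at (pt C x) d) (δ-chain C le)) (at-+ (base C) d x (x ⊓ μ C))

    move-still : ∀ {v} → ¬ Mov v → move v ≡ v
    move-still {v} ¬mv = trans (cong (at v d) (δ-still ¬mv)) (at-zero v d)

    move-op : ∀ (C : Seg) {y} → y < μ C → move (pt C y) ≡ pt C (y + y)
    move-op C {y} lt = trans (move-chain C (<quota⇒≤len w (len C) lt))
      (cong (λ n → pt C (y + n)) (m≤n⇒m⊓n≡m (<⇒≤ lt)))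

    move-new : ∀ (C : Seg) {y} → y < μ C → move (pt C y) ⊕ vec d ≡ pt C (suc (y + y))
    move-new C {y} lt = trans (cong (_⊕ vec d) (move-op C lt)) (sym (at-suc (base C) d (y + y)))

    op-reach : ∀ {u} → Op u → Reach R u
    op-reach (C , y , lt , refl) = reach-chain⁺ cap C (<quota⇒≤len w (len C) lt) (<quota⇒≤w w (len C) lt)

    reach-new : ∀ (C : Seg) {z} → z ≤ len C → z ≤ suc (w + w) → Reach R′ (pt C z)
    reach-new C le le′ = reach-chain⁺ cap′ C le (≤-trans le′ (≤-reflexive (sym doubled)))

    segmentOf : ∀ (C : Seg) → 1 ≤ len C → Segment T u₀ (suc j) (base C) d (len C)
    segmentOf C 1≤len with len C in eq | route C | maximal C
    segmentOf C (s≤s z≤n) | suc m | r | mx = record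
      { nonempty     = s≤s z≤n
      ; before       = base C ∷ behind C
      ; path-to-base = subst (λ u → RootPath u (base C ∷ behind C)) (at-zero (base C) d) (path C z≤n)
      ; path-to-end  = r
      ; base-dist    = cong suc (dist C)
      ; end-dist     = segments-suc C m
      ; maximal      = mx
      }

    chainOf : ∀ {b m} → Segment T u₀ (suc j) b d m → Σ[ C ∈ Seg ] base C ≡ b × len C ≡ m
    chainOf {b} {suc m} s with path-head (Segment.path-to-base s)
    ... | qs , eq = record
      { base    = b
      ; behind  = qs
      ; len     = suc m
      ; route   = subst (λ ps → RootPath _ (line b d (suc m) ++ ps)) eq (Segment.path-to-end s)
      ; dist    = trans (cong segments (sym eq)) (suc-injective (Segment.base-dist s))
      ; turn    = trans (sym (segments-line-first b d qs m))
                    (trans (cong (λ ps → segments (line b d (suc m) ++ ps)) (sym eq))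
                      (trans (Segment.end-dist s) (trans (sym (Segment.base-dist s)) (cong (suc ∘ segments) eq))))
      ; maximal = Segment.maximal s
      } , refl , refl
    chainOf {m = zero} s with () ← Segment.nonempty s

    module _ {S S′ : Shape} (G : Grown R S) (G′ : Grown R′ S′) where

      ops : Operations S
      ops = record { dir = d ; Op = Op ; op? = op? ; op∈ = λ {u} op → from (proj₁ G u) (op-reach op) }

      open Operations ops hiding (dir; Op; op?; op∈)

      toTree : ∀ {a b ps} → Path S a b ps → Path T a b ps
      toTree start          = start
      toTree (extend p e n) = extend (toTree p) (proj₁ (to (proj₂ G _ _) e)) n

      -- If c operated toward its parent, the parent would be the next chain point, and its root
      -- path would pass through c. Hence operations point away from the anchor.
      ¬toward-parent : ∀ {p c ps} → RootPath p ps → RootPath c (c ∷ ps) → ¬ Toward c p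
      ¬toward-parent ppath cpath ((C , y , lt , refl) , refl)
        with path-unique ppath (subst (λ u → RootPath u (pathList C (suc y))) (at-suc (base C) d y) (path C y<len))
           | line-head (base C) d (behind C) y
        where
        y<len : suc y ≤ len C
        y<len = <quota⇒<len w (len C) lt
      ... | refl | _ , eq = proj₂ (proj₂ (path-tail cpath)) (there (subst (pt C y ∈_) (sym eq) (here refl)))

      splits⇒op : ∀ {p c ps} → RootPath p ps → RootPath c (c ∷ ps) → Splits p c → Toward p c
      splits⇒op ppath cpath (inj₁ t) = t
      splits⇒op ppath cpath (inj₂ t) = contradiction t (¬toward-parent ppath cpath)

      toward⇒moving : ∀ {p c} → Toward p c → Mov c
      toward⇒moving ((C , y , lt , refl) , refl) =
        C , y , <quota⇒<len w (len C) lt , sym (at-suc (base C) d y)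

      -- Along a chain an edge contributes `vec d` exactly where min x μ increases; a still edge
      -- contributes nothing and has `δ` equal to 0 at both ends.
      displacement-δ : ∀ {v ps} → Path S u₀ v ps → displacement ps ≡ δ v • vec d
      displacement-δ start = cong (_• vec d) (sym (δ-still (λ m → 0≢1+n (proj₁ (moving⁻ j d start m)))))
      displacement-δ path@(extend {p} {c} path′ e c∉) with path-head path′
      ... | qs , refl = trans (cong (shift ⊕_) (displacement-δ path′))
              (step (edgeView (toTree path′) (toTree path) (reached⇒≤ (suc j) cap (c ∷ p ∷ qs)
                (reach-path (toTree path) (proj₂ (proj₂ (to (proj₂ G _ _) e)))))))
        where
        shift : Point
        shift = if does (splits? p c) then c ⊖ p else origin
        moved : Splits p c → shift ≡ c ⊖ p
        moved s = cong (if_then c ⊖ p else origin) (dec-true (splits? p c) s)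
        unmoved : ¬ Splits p c → shift ≡ origin
        unmoved ¬s = cong (if_then c ⊖ p else origin) (dec-false (splits? p c) ¬s)
        step : EdgeView p c → shift ⊕ δ p • vec d ≡ δ c • vec d
        step (still ¬mp ¬mc) = trans (cong₂ (λ s n → s ⊕ n • vec d) (unmoved ¬splits) (δ-still ¬mp))
                                     (cong (_• vec d) (sym (δ-still ¬mc)))
          where
          ¬splits : ¬ Splits p c
          ¬splits s = ¬mc (toward⇒moving (splits⇒op (toTree path′) (toTree path) s))
        step (along C x le refl refl) with x <? μ C
        ... | yes lt = begin
          shift ⊕ δ p • vec d               ≡⟨ cong₂ (λ s n → s ⊕ n • vec d) shift≡ (δ-chain C (<⇒≤ le)) ⟩
          vec d ⊕ (x ⊓ μ C) • vec d         ≡⟨ •-suc (x ⊓ μ C) (vec d) ⟩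
          suc (x ⊓ μ C) • vec d             ≡⟨ cong (_• vec d) (⊓-shift-< lt) ⟨
          (suc x ⊓ μ C) • vec d             ≡⟨ cong (_• vec d) (δ-chain C le) ⟨
          δ c • vec d                       ∎
          where
          open ≡-Reasoning
          shift≡ : shift ≡ vec d
          shift≡ = trans (moved (inj₁ ((C , x , lt , refl) , at-suc (base C) d x)))
                     (trans (cong (_⊖ p) (at-suc (base C) d x)) (⊕-⊖-cancel p (vec d)))
        ... | no ≮ = begin
          shift ⊕ δ p • vec d               ≡⟨ cong₂ (λ s n → s ⊕ n • vec d) (unmoved ¬splits) (δ-chain C (<⇒≤ le)) ⟩
          origin ⊕ (x ⊓ μ C) • vec d        ≡⟨ ⊕-identityˡ _ ⟩
          (x ⊓ μ C) • vec d                 ≡⟨ cong (_• vec d) (⊓-shift-≮ ≮) ⟨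
          (suc x ⊓ μ C) • vec d             ≡⟨ cong (_• vec d) (δ-chain C le) ⟨
          δ c • vec d                       ∎
          where
          open ≡-Reasoning
          ¬splits : ¬ Splits p c
          ¬splits s = ≮ (op-chain C (<⇒≤ le) (proj₁ (splits⇒op (toTree path′) (toTree path) s)))

      shiftOf : Body → ℕ
      shiftOf (old v) = δ v
      shiftOf (new u) = suc (δ u)

      final-at : ∀ x → final move x ≡ at (initial x) d (shiftOf x)
      final-at (old v) = refl
      final-at (new u) = sym (at-suc u d (δ u))

      δ≤shiftOf : ∀ x → δ (initial x) ≤ shiftOf x
      δ≤shiftOf (old v) = ≤-refl
      δ≤shiftOf (new u) = n≤1+n _

      -- A node passed by another one lies on the same segment, farther from
      -- the base, and so is itself displaced at least as much.
      overtaken : ∀ x t → Present x → 1 ≤ t → t ≤ shiftOf x → shiftOf x ≤ δ (at (initial x) d t)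
      overtaken (old v) t v∈ 1≤t t≤ with moving? j d v
      ... | no ¬mv = contradiction (≤-trans 1≤t (≤-trans t≤ (≤-reflexive (δ-still ¬mv)))) λ ()
      ... | yes (C , x , le , refl) = begin
        δ (pt C (suc x))          ≡⟨ δ≡ ⟩
        suc x ⊓ μ C               ≤⟨ ⊓-monoˡ-≤ (μ C) (m≤m+n (suc x) t) ⟩
        (suc x + t) ⊓ μ C         ≡⟨ δ-chain C x+t≤len ⟨
        δ (pt C (suc x + t))      ≡⟨ cong δ (at-+ (base C) d (suc x) t) ⟨
        δ (at (pt C (suc x)) d t) ∎
        where
        open ≤-Reasoning
        δ≡ = δ-chain C le
        x+t≤len : suc x + t ≤ len C
        x+t≤len = ≤-trans (+-monoʳ-≤ (suc x) (≤-trans t≤ (≤-reflexive δ≡)))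
          (old≤len w (len C) (reach-chain⁻ C le (to (proj₁ G _) v∈)) le)
      overtaken (new u) t (C , y , lt , refl) 1≤t t≤ = begin
        suc (δ (pt C y))          ≡⟨ cong suc δ≡ ⟩
        suc y                     ≤⟨ ⊓-glb (≤-trans (≤-reflexive (+-comm 1 y)) (+-monoʳ-≤ y 1≤t)) lt ⟩
        (y + t) ⊓ μ C             ≡⟨ δ-chain C y+t≤len ⟨
        δ (pt C (y + t))          ≡⟨ cong δ (at-+ (base C) d y t) ⟨
        δ (at (pt C y) d t)       ∎
        where
        open ≤-Reasoning
        δ≡ : δ (pt C y) ≡ y
        δ≡ = trans (δ-chain C (<quota⇒≤len w (len C) lt)) (m≤n⇒m⊓n≡m (<⇒≤ lt))
        y+t≤len : y + t ≤ len C
        y+t≤len = ≤-trans (+-monoʳ-≤ y (≤-trans t≤ (≤-reflexive (cong suc δ≡))))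
          (≤-trans (≤-reflexive (+-suc y y)) (<quota⇒new≤len w (len C) lt))

      -- Bodies with the same start and shift coincide, since a generated node travels one unit
      -- farther than its generator. For a positive lead, catching up needs a strictly larger shift
      -- behind, against `overtaken`.
      no-catch : ∀ a r (1≤a : 1 ≤ a) {x y} → Present x → x ≢ y →
                 ∀ t → initial y ≡ at (initial x) d t → ¬ Catch a r 1≤a t (shiftOf x) (shiftOf y)
      no-catch a r 1≤a {x} {y} _ x≢y zero eq c =
        x≢y (same-body x y (sym (trans eq (at-zero _ d))) (sym (catch-zero a r 1≤a c)))
        where
        same-body : ∀ x y → initial x ≡ initial y → shiftOf x ≡ shiftOf y → x ≡ y
        same-body (old _) (old _) refl _  = refl
        same-body (new _) (new _) refl _  = refl
        same-body (old _) (new _) refl eq = contradiction (sym eq) 1+n≢n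
        same-body (new _) (old _) refl eq = contradiction eq 1+n≢n
      no-catch a r 1≤a {x} {y} px _ (suc t) eq c = <⇒≱ (begin-strict
        shiftOf y                      <⟨ m≤n+m _ t ⟩
        t + suc (shiftOf y)            ≡⟨ +-suc t _ ⟩
        suc t + shiftOf y              ≤⟨ caught ⟩
        shiftOf x                      ∎) (begin
        shiftOf x                      ≤⟨ overtaken x (suc t) px (s≤s z≤n) (≤-trans (m≤m+n _ _) caught) ⟩
        δ (at (initial x) d (suc t))   ≡⟨ cong δ eq ⟨
        δ (initial y)                  ≤⟨ δ≤shiftOf y ⟩
        shiftOf y                      ∎)
        where
        open ≤-Reasoning
        caught = catch-≤ a r 1≤a (suc t) c

      collision-free : ∀ {x y} → Present x → Present y → x ≢ y → ∀ a r → 1 ≤ a →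
                       r • initial x ⊕ a • final move x ≢ r • initial y ⊕ a • final move y
      collision-free {x} {y} px py x≢y a r 1≤a eq
        with meet a r 1≤a d (subst₂ (λ p q → r • initial x ⊕ a • p ≡ r • initial y ⊕ a • q)
                               (final-at x) (final-at y) eq)
      ... | inj₁ (t , e , c) = no-catch a r 1≤a {x} {y} px x≢y t e c
      ... | inj₂ (t , e , c) = no-catch a r 1≤a {y} {x} py (x≢y ∘ sym) t e c

      reach-final : ∀ {x} → Present x → Reach R′ (final move x)
      reach-final {old v} v∈ with moving? j d v
      ... | no ¬mv = subst (Reach R′) (sym (move-still ¬mv)) (reach-still⁺ ¬mv (to (proj₁ G v) v∈))
      ... | yes (C , x , le , refl) = subst (Reach R′) (sym (move-chain C le))
        (reach-new C (old≤len w (len C) x≤w le) (old≤cap w (len C) x≤w))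
        where x≤w = reach-chain⁻ C le (to (proj₁ G _) v∈)
      reach-final {new u} (C , y , lt , refl) = subst (Reach R′) (sym (move-new C lt))
        (reach-new C (<quota⇒new≤len w (len C) lt) (<quota⇒new≤cap w (len C) lt))

      Link : Point → Point → Set
      Link p q = ∃[ x ] ∃[ y ] SymClosure Edge x y × final move x ≡ p × final move y ≡ q

      link-sym : ∀ {p q} → Link p q → Link q p
      link-sym (x , y , e , ex , ey) = y , x , symmetric Edge e , ey , ex

      edge-present : ∀ {x y} → SymClosure Edge x y → Present x × Present y
      edge-present (fwd e) = ends e
        where
        ends : ∀ {x y} → Edge x y → Present x × Present y
        ends (kept e _)          = Shape.~-node S e , Shape.~-node S (Shape.~-sym S e)
        ends (grown op)          = from (proj₁ G _) (op-reach op) , op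
        ends (spliced e (op , _)) = op , Shape.~-node S (Shape.~-sym S e)
      edge-present (bwd e) = Product.swap (edge-present (fwd e))

      chain-link : ∀ (C : Seg) {z} → suc z ≤ len C → suc z ≤ suc (w + w) → Link (pt C z) (pt C (suc z))
      chain-link C z<len z<cap with edgeOrigin {w} {len C} z<len z<cap
      ... | kept x ≮ x<w refl = old (pt C x) , old (pt C (suc x)) , fwd (Edge.kept x~ ¬splits) ,
              move-chain C (<⇒≤ x<len) , trans (move-chain C x<len) (cong (λ n → pt C (suc x + n)) (⊓-shift-≮ ≮))
        where
        x<len : suc x ≤ len C
        x<len = ≤-trans (s≤s (m≤m+n x _)) z<len
        x~ : Shape._~_ S (pt C x) (pt C (suc x))
        x~ = from (proj₂ G _ _)
          (edge C x<len , reach-chain⁺ cap C (<⇒≤ x<len) (<⇒≤ x<w) , reach-chain⁺ cap C x<len x<w)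
        ¬splits : ¬ Splits (pt C x) (pt C (suc x))
        ¬splits s = ≮ (op-chain C (<⇒≤ x<len) (proj₁ (splits⇒op (path C (<⇒≤ x<len)) (path C x<len) s)))
      ... | grown y lt refl = old (pt C y) , new (pt C y) , fwd (Edge.grown (C , y , lt , refl)) ,
              move-op C lt , move-new C lt
      ... | spliced y lt y<w refl = new (pt C y) , old (pt C (suc y)) ,
              fwd (Edge.spliced y~ ((C , y , lt , refl) , at-suc (base C) d y)) , move-new C lt ,
              trans (move-chain C y<len)
                (cong (pt C) (trans (cong (λ n → suc y + n) (m≤n⇒m⊓n≡m lt)) (cong suc (+-suc y y))))
        where
        y<len : suc y ≤ len C
        y<len = <quota⇒<len w (len C) lt
        y~ : Shape._~_ S (pt C y) (pt C (suc y))
        y~ = from (proj₂ G _ _)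
          (edge C y<len , reach-chain⁺ cap C (<⇒≤ y<len) (<⇒≤ y<w) , reach-chain⁺ cap C y<len y<w)

      child-link : ∀ {p c ps} → RootPath p ps → RootPath c (c ∷ ps) → p ~ c → R′ (c ∷ ps) → Link p c
      child-link {p} {c} {ps} ppath cpath e r with edgeView ppath cpath (reached⇒≤ (suc j) cap′ (c ∷ ps) r)
      ... | along C x le refl refl = chain-link C le (≤-trans
              (reached-chain⁻ cap′ C (suc x) (reach-path {R′} (path C le) (_ , cpath , r))) (≤-reflexive doubled))
      ... | still ¬mp ¬mc = old p , old c , fwd (Edge.kept (from (proj₂ G p c)
              (e , reach-still⁻ ¬mp (_ , ppath , reached-tail (suc j) cap′ cpath ppath r) ,
               reach-still⁻ ¬mc (_ , cpath , r)))
              (λ s → ¬mc (toward⇒moving (splits⇒op ppath cpath s)))) , move-still ¬mp , move-still ¬mc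

      link : ∀ {p q} → p ~ q → Reach R′ p → Reach R′ q → Link p q
      link e (ps , ppath , rp) rq with neighbour ppath e
      ... | inj₁ qpath = child-link ppath qpath e (reach-path qpath rq)
      ... | inj₂ (qs , refl , qpath) = link-sym (child-link qpath ppath (~-sym e) rp)

      kept-adjacent : ∀ {p c ps} → RootPath p ps → RootPath c (c ∷ ps) → p ~ c → R (c ∷ ps) → ¬ Splits p c →
                      move p ~ move c
      kept-adjacent {p} {c} {ps} ppath cpath e r ¬s with edgeView ppath cpath (reached⇒≤ (suc j) cap (c ∷ ps) r)
      ... | still ¬mp ¬mc = subst₂ _~_ (sym (move-still ¬mp)) (sym (move-still ¬mc)) e
      ... | along C x le refl refl = subst₂ _~_ (sym (move-chain C (<⇒≤ le)))
              (sym (trans (move-chain C le) (cong (λ n → pt C (suc x + n)) (⊓-shift-≮ ≮))))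
              (edge C (subst (λ n → suc x + n ≤ len C) (⊓-shift-≮ ≮)
                (old≤len w (len C) (reach-chain⁻ C le (_ , cpath , r)) le)))
        where
        ≮ : ¬ x < μ C
        ≮ lt = ¬s (inj₁ ((C , x , lt , refl) , at-suc (base C) d x))

      edge-adjacent : ∀ {x y} → Edge x y → final move x ~ final move y
      edge-adjacent (kept {u} {v} e ¬s) with to (proj₂ G u v) e
      ... | e′ , (_ , upath , ru) , rv with neighbour upath e′
      ...   | inj₁ vpath = kept-adjacent upath vpath e′ (reach-path vpath rv) ¬s
      ...   | inj₂ (_ , refl , vpath) = ~-sym (kept-adjacent vpath upath (~-sym e′) ru (¬s ∘ Sum.swap))
      edge-adjacent (grown (C , y , lt , refl)) =
        subst₂ _~_ (sym (move-op C lt)) (sym (move-new C lt)) (edge C (<quota⇒new≤len w (len C) lt))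
      edge-adjacent (spliced e ((C , y , lt , refl) , refl)) =
        subst₂ _~_ (sym (move-new C lt)) (sym moved) (edge C 2+y+y≤len)
        where
        y<len : suc y ≤ len C
        y<len = <quota⇒<len w (len C) lt
        y<w : suc y ≤ w
        y<w = reach-chain⁻ C y<len (subst (Reach R) (sym (at-suc (base C) d y)) (proj₂ (proj₂ (to (proj₂ G _ _) e))))
        twice : suc y + suc y ⊓ μ C ≡ 2 + (y + y)
        twice = trans (cong (λ n → suc y + n) (m≤n⇒m⊓n≡m lt)) (cong suc (+-suc y y))
        moved : move (pt C y ⊕ vec d) ≡ pt C (2 + (y + y))
        moved = trans (cong move (sym (at-suc (base C) d y))) (trans (move-chain C y<len) (cong (pt C) twice))
        2+y+y≤len : 2 + (y + y) ≤ len C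
        2+y+y≤len = subst (_≤ len C) twice (old≤len w (len C) y<w y<len)

      -- On a chain, the origin of the edge arriving at p already provides the body that ends at p.
      reach-body : ∀ {p} → Reach R′ p → ∃[ x ] Present x × final move x ≡ p
      reach-body {p} r with moving? j d p
      ... | no ¬mp = old p , from (proj₁ G p) (reach-still⁻ ¬mp r) , move-still ¬mp
      ... | yes (C , x , le , refl)
        with _ , y , e , _ , ey ← chain-link C le
               (≤-trans (reached-chain⁻ cap′ C (suc x) (reach-path (path C le) r)) (≤-reflexive doubled)) =
        y , proj₂ (edge-present e) , ey

      doublingStep : Step u₀ S S′
      doublingStep = record
        { tree           = λ p 3≤ e → tree (toTree p) 3≤ (proj₁ (to (proj₂ G _ _) e))
        ; anchor         = from (proj₁ G u₀) (_ , start , inj₁ (s≤s z≤n))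
        ; ops            = ops
        ; move           = move
        ; move-def       = λ {v} p → cong (v ⊕_) (sym (displacement-δ p))
        ; collision-free = λ {x} {y} → collision-free {x} {y}
        ; nodes′         = λ p → mk⇔ (reach-body ∘ to (proj₁ G′ p))
            λ { (x , px , refl) → from (proj₁ G′ _) (reach-final {x} px) }
        ; edges′         = λ p q → mk⇔ (λ e → let e′ , rp , rq = to (proj₂ G′ p q) e in link e′ rp rq)
            λ { (x , y , e , refl , refl) → from (proj₂ G′ _ _)
                  (adjacent e , reach-final {x} (proj₁ (edge-present e)) , reach-final {y} (proj₂ (edge-present e))) }
        }
        where
        adjacent : ∀ {x y} → SymClosure Edge x y → final move x ~ final move y
        adjacent (fwd e) = edge-adjacent e
        adjacent (bwd e) = ~-sym (edge-adjacent e)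

      fastLineStep : FastLineStep T u₀ (suc j) doublingStep
      fastLineStep = record
        { only-segments = λ { (C , y , lt , refl) → base C , len C ,
            segmentOf C (≤-trans (s≤s z≤n) (<quota⇒<len w (len C) lt)) , on-line C y (<quota⇒≤len w (len C) lt) }
        ; all-segments = λ s → let C , base≡ , len≡ = chainOf s in all C base≡ len≡
        }
        where
        on-line : ∀ (C : Seg) y → y ≤ len C → pt C y ∈ base C ∷ line (base C) d (len C)
        on-line C zero    _  = here (at-zero (base C) d)
        on-line C (suc y) le = there (∈-line⁺ (base C) d (len C) le)
        offset : ∀ (C : Seg) {u} → u ∈ base C ∷ line (base C) d (len C) → ∃[ x ] x ≤ len C × u ≡ pt C x
        offset C (here refl) = 0 , z≤n , sym (at-zero (base C) d)
        offset C (there u∈)  = ∈-line⁻ (base C) d (len C) u∈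
        all : ∀ (C : Seg) {b m} → base C ≡ b → len C ≡ m →
          (∀ {u} → u ∈ Shape.nodes S → u ∈ b ∷ line b d m → Op u) ⊎
          (∀ {u} → u ∈ line b d m → u ∈ Shape.nodes S′)
        -- With room for 2 w + 1 nodes beyond the base the quota is w + 1 and every node present
        -- operates; a shorter segment is complete after this step.
        all C refl refl with suc (w + w) ≤? len C
        ... | yes full = inj₁ λ u∈S u∈ → operate u∈S (offset C u∈)
          where
          operate : ∀ {u} → u ∈ Shape.nodes S → ∃[ x ] x ≤ len C × u ≡ pt C x → Op u
          operate u∈S (x , le , refl) = C , x , quota-full w (len C) full (reach-chain⁻ C le (to (proj₁ G _) u∈S)) , refl
        ... | no short = inj₂ λ u∈ → complete (offset C (there u∈))
          where
          complete : ∀ {u} → ∃[ x ] x ≤ len C × u ≡ pt C x → u ∈ Shape.nodes S′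
          complete (x , le , refl) = from (proj₁ G′ _) (reach-new C le (≤-trans le (<⇒≤ (≰⇒> short))))

  -- Composing steps into phases and phases into a process.

  grown-cong : ∀ {R R′ S} → (∀ {v ps} → RootPath v ps → R ps → R′ ps) →
               (∀ {v ps} → RootPath v ps → R′ ps → R ps) → Grown R S → Grown R′ S
  grown-cong {R} {R′} f g (ns , es) =
    (λ p → mk⇔ (⇒reach ∘ to (ns p)) (from (ns p) ∘ ⇐reach)) ,
    (λ p q → mk⇔ (λ e → let e′ , rp , rq = to (es p q) e in e′ , ⇒reach rp , ⇒reach rq)
                 (λ (e , rp , rq) → from (es p q) (e , ⇐reach rp , ⇐reach rq)))
    where
    ⇒reach : ∀ {v} → Reach R v → Reach R′ v
    ⇒reach (ps , p , r) = ps , p , f p r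
    ⇐reach : ∀ {v} → Reach R′ v → Reach R v
    ⇐reach (ps , p , r) = ps , p , g p r

  -- A path with at least one segment has a nonempty last run, so cap 0 admits nothing at distance i
  -- + 1: a phase starts where the previous one ended.
  reached-none⁻ : ∀ {i} ps → Reached (suc i) none ps → segments ps ≤ i
  reached-none⁻ ps (inj₁ lt) = ≤-pred lt
  reached-none⁻ ps (inj₂ (seg , le)) =
    contradiction (trans (sym (run≡0⇒segments≡0 ps (n≤0⇒n≡0 le))) seg) 0≢1+n

  reached-all : ∀ {i v ps} cap → (∀ d → Shape.size T ≤ cap d) → RootPath v ps →
                segments ps ≤ i → Reached i cap ps
  reached-all {ps = ps} cap large p le with m≤n⇒m<n∨m≡n le
  ... | inj₁ lt = inj₁ lt
  ... | inj₂ eq = inj₂ (eq , ≤-trans (run≤length ps) (≤-trans (path-length u₀∈ p) (large _)))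

  -- The process is assembled from its end. Quantifying over `S` lets one continuation start from
  -- any shape with the right points and edges, be it a `stage` or `singleton u₀`.
  Finishes : ℕ → (Dir → ℕ) → ℕ → Set₁
  Finishes i cap t = ∀ {S} → Grown (Reached i cap) S → ∃[ g ] Phase T u₀ i {S} {t} g

  doubleOnce : ∀ {j t} d cap → Finishes (suc j) (double d cap) t → Finishes (suc j) cap (suc t)
  doubleOnce {j} d cap rest G with rest {stage j (double d cap)} (stage-grown j (double d cap))
  ... | g , ph = D.doublingStep G G′ ∷ g , grow (D.fastLineStep G G′) ph
    where
    module D = DoublingStep j d cap (double d cap) (double-same d cap) (double-other d cap)
    G′ = stage-grown j (double d cap)

  doubleMany : ∀ {j t} n d cap → Finishes (suc j) (doubles n d cap) t → Finishes (suc j) cap (n + t)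
  doubleMany zero    d cap rest = rest
  doubleMany (suc n) d cap rest = doubleOnce d cap (doubleMany n d (double d cap) rest)

  module _ (L : ℕ) (size< : Shape.size T < 2 ^ L) where

    phase : ∀ {j t} → Finishes (2 + j) none t → Finishes (suc j) none (L + (L + (L + (L + t))))
    phase {j} rest = doubleMany L north _ (doubleMany L east _ (doubleMany L south _ (doubleMany L west _ completed)))
      where
      -- No step is spent here: with all caps at least the size of `T`, the same shape ends phase j
      -- + 1 and starts phase j + 2 with caps reset to 0.
      completed : Finishes (suc j) (allDirs L) _
      completed {S} G with rest {S} (grown-cong {S = S}
                              (λ {_} {ps} _ r → inj₁ (s≤s (reached⇒≤ (suc j) (allDirs L) ps r)))
                              (λ {_} {ps} p r → reached-all (allDirs L) (allDirs-large L size<) p (reached-none⁻ ps r)) G)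
      ... | g , ph = g , next (grown-cong {S = S} (λ {_} {ps} _ → reached⇒≤ (suc j) (allDirs L) ps)
                                (reached-all (allDirs L) (allDirs-large L size<)) G) ph

    duration : ℕ → ℕ
    duration zero    = 0
    duration (suc n) = L + (L + (L + (L + duration n)))

    phases : ∀ n j → (∀ {v ps} → RootPath v ps → segments ps ≤ j + n) → Finishes (suc j) none (duration n)
    phases zero j bound {S} (ns , es) = done S≋T , finish
      where
      everything : ∀ {v} → v ∈ Shape.nodes T → Reach (Reached (suc j) none) v
      everything v∈ with path-to v∈
      ... | ps , p = ps , p , inj₁ (s≤s (≤-trans (bound p) (≤-reflexive (+-identityʳ j))))
      S≋T : S ≋ T
      S≋T = (λ p → mk⇔ (reach-node ∘ to (ns p)) (from (ns p) ∘ everything)) ,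
            (λ p q → mk⇔ (proj₁ ∘ to (es p q))
              (λ e → from (es p q) (e , everything (~-node e) , everything (~-node (~-sym e)))))
    phases (suc n) j bound = phase (phases n (suc j) (λ p → ≤-trans (bound p) (≤-reflexive (+-suc j n))))

    duration≡ : ∀ n → duration n ≡ n * (4 * L)
    duration≡ zero    = refl
    duration≡ (suc n) = trans (cong (λ t → L + (L + (L + (L + t)))) (duration≡ n)) (ring L (n * (4 * L)))
      where
      ring : ∀ l t → l + (l + (l + (l + t))) ≡ 4 * l + t
      ring = ℕ-Solver.solve-∀

  singleton-grown : Grown (Reached 1 none) (singleton u₀)
  singleton-grown =
    (λ p → mk⇔ (λ { (here refl) → _ , start , inj₁ (s≤s z≤n) }) (here ∘ only-root)) ,
    (λ p q → mk⇔ (λ ()) λ (e , rp , rq) → not-self e (trans (only-root rp) (sym (only-root rq))))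
    where
    only-root : ∀ {v} → Reach (Reached 1 none) v → v ≡ u₀
    only-root (_ , start , _) = refl
    only-root (_ , extend {b} {c} p _ _ , r) with path-head p
    ... | qs , refl with () ← reached-none⁻ (c ∷ b ∷ qs) r
    not-self : ∀ {p q} → p ~ q → p ≢ q
    not-self {p} e refl with () ← trans (sym (~-adjacent e)) (manhattan-refl p)

  -- The hypothesis bounds only root-to-leaf paths. Any root path extends to one, and extension
  -- never loses segments.
  leafward : ∀ {v ps} → RootPath v ps → ∃[ u ] ∃[ qs ] RootToLeaf T u₀ u qs × segments ps ≤ segments qs
  leafward p = go (Shape.size T) p (m≤n+m _ _)
    where
    go : ∀ fuel {v ps} → RootPath v ps → Shape.size T ≤ length ps + fuel →
         ∃[ u ] ∃[ qs ] RootToLeaf T u₀ u qs × segments ps ≤ segments qs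
    go fuel {v} {ps} p bound with any? (λ u → (v ~? u) ×-dec ¬? (u ∈? ps)) (Shape.nodes T)
    ... | no none-left = v , ps , (p , closed) , ≤-refl
      where
      closed : ∀ u → v ~ u → u ∈ ps
      closed u e with u ∈? ps
      ... | yes u∈ = u∈
      ... | no  u∉ = contradiction (lose (~-node (~-sym e)) (e , u∉)) none-left
    ... | yes child with find child
    go zero {v} {ps} p bound | yes child | u , _ , e , u∉ =
      contradiction (path-length u₀∈ (extend p e u∉)) (<⇒≱ (s≤s (≤-trans bound (≤-reflexive (+-identityʳ _)))))
    go (suc fuel) {v} {ps} p bound | yes child | u , _ , e , u∉
      with go fuel (extend p e u∉) (≤-trans bound (≤-reflexive (+-suc (length ps) fuel))) | path-head p
    ... | u′ , qs , leaf , le | rs , refl = u′ , qs , leaf , ≤-trans (segments-mono u v rs) le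

theorem3p1 : ∀ (c : ℕ) → ∃[ C ]
    (∀ (T : Shape) → IsTree T →
    ∀ (u₀ : Point) → u₀ ∈ Shape.nodes T →
    ∀ (k : ℕ) → (∀ {v ps} → RootToLeaf T u₀ v ps → turningPoints ps ≤ c * k) →
    ∃[ t ] ∃[ g ] (BFSOnLineSegments T u₀ {t} g × t ≤ C * (k * ⌊log₂ Shape.size T ⌋)))
-- The 8 is four directions times 2, since 1 + ⌊log₂ n⌋ is at most twice ⌊log₂ n⌋ once n is at least
-- 2.
theorem3p1 c = 8 * c , λ T tree u₀ u₀∈ k bound → result T tree u₀ u₀∈ k bound (Shape.size T ≤? 1)
  where
  result : ∀ (T : Shape) → IsTree T →
    ∀ (u₀ : Point) → u₀ ∈ Shape.nodes T →
    ∀ (k : ℕ) → (∀ {v ps} → RootToLeaf T u₀ v ps → turningPoints ps ≤ c * k) →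
    Dec (Shape.size T ≤ 1) →
    ∃[ t ] ∃[ g ] (BFSOnLineSegments T u₀ {t} g × t ≤ 8 * c * (k * ⌊log₂ Shape.size T ⌋))
  result T tree u₀ u₀∈ k bound size≤1? = conclude size≤1?
    where
    open Tree T tree u₀ u₀∈
    l = ⌊log₂ Shape.size T ⌋
    size< = n<2^[1+log₂n] (Shape.size T)
    conclude : Dec (Shape.size T ≤ 1) → ∃[ t ] ∃[ g ] (BFSOnLineSegments T u₀ {t} g × t ≤ 8 * c * (k * l))
    -- Here the logarithm is 0 and the bound allows no step at all; zero phases suffice, as the root
    -- is all of `T`.
    conclude (yes size≤1)
      with phases (suc l) size< 0 0 (λ {_} {ps} p → short ps (≤-trans (path-length u₀∈ p) size≤1)) singleton-grown
      where
      short : ∀ ps → length ps ≤ 1 → segments ps ≤ 0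
      short []          _ = z≤n
      short (_ ∷ [])    _ = z≤n
      short (_ ∷ _ ∷ _) (s≤s ())
    ... | g , ph = 0 , g , ph , z≤n
    -- The number of phases is the given bound rather than the depth of `T`; phases past the depth
    -- consist of steps without operations.
    conclude (no size≰1) with phases (suc l) size< (c * k) 0 few singleton-grown
      where
      few : ∀ {v ps} → Path T u₀ v ps → segments ps ≤ c * k
      few p with leafward p
      ... | _ , _ , leaf , le = ≤-trans le (≤-trans pred[n]≤n (bound leaf))
    ... | g , ph = _ , g , ph , (begin
      duration (suc l) size< (c * k)   ≡⟨ duration≡ (suc l) size< (c * k) ⟩
      c * k * (4 * suc l)              ≤⟨ *-monoʳ-≤ (c * k) (*-monoʳ-≤ 4 (+-monoˡ-≤ l 1≤l)) ⟩
      c * k * (4 * (l + l))            ≡⟨ ring c k l ⟩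
      8 * c * (k * l)                  ∎)
      where
      open ≤-Reasoning
      1≤l : 1 ≤ l
      1≤l = ≤-trans (≤-reflexive (sym (⌊log₂[2^n]⌋≡n 1))) (⌊log₂⌋-mono-≤ (≰⇒> size≰1))
      ring : ∀ c k l → c * k * (4 * (l + l)) ≡ 8 * c * (k * l)
      ring = ℕ-Solver.solve-∀
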